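{- Let $m\in\mathbb{N}$ and let $p_1,\ldots,p_m$ be minimal idempotents in $(\beta\mathbb{N},+)$. Then for every $A\in\bigotimes_{i=1}^m p_i$ and every $T\in\mathcal{P}_f(\mathbb{P})$ there exist functions $\alpha_1,\ldots,\alpha_m:\mathcal{P}_f(\mathbb{N}^{\mathbb{N}})\to\mathbb{N}$ and $H_1,\ldots,H_m:\mathcal{P}_f(\mathbb{N}^{\mathbb{N}})\to\mathcal{P}_f(\mathbb{N})$ such that (1) if $G,K\in\mathcal{P}_f(\mathbb{N}^{\mathbb{N}})$ and $G\subsetneq K$, then $H_i(G)<H_i(K)$ for every $i\in\{1,\ldots,m\}$; and (2) if $G_1\subsetneq G_2\subsetneq\cdots\subsetneq G_n\subsetneq\cdots$ is an infinite sequence in $\mathcal{P}_f(\mathbb{N}^{\mathbb{N}})$, then for all $\beta_1<\beta_2<\cdots<\beta_m$ in $\mathcal{P}_f(\mathbb{N})$, all $f_i\in G_i$ ($i\in\mathbb{N}$), and all $P_1,\ldots,P_m\in T$, $$\left(\sum_{i\in\beta_1}\alpha_1(G_i)+P_1\Bigl(\sum_{i\in\beta_1}\sum_{t\in H_1(G_i)}f_i(t)\Bigr),\ldots,\sum_{i\in\beta_m}\alpha_m(G_i)+P_m\Bigl(\sum_{i\in\beta_m}\sum_{t\in H_m(G_i)}f_i(t)\Bigr)\right)\in A.$$ In fact, the same holds for arbitrary idempotents $p_1,\ldots,p_m$ of $(\mathcal{J}_p,+)$ (in place of minimal idempotents).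
   Context: $\mathbb{N}$ is the set of positive integers; $\mathcal{P}_f(X)$ is the set of nonempty finite subsets of $X$; $\mathbb{N}^{\mathbb{N}}$ is the set of all functions $\mathbb{N}\to\mathbb{N}$. For $\beta,\gamma\in\mathcal{P}_f(\mathbb{N})$, $\beta<\gamma$ means $\max\beta<\min\gamma$. $\mathbb{P}$ is the set of one-variable polynomials with integer coefficients and zero constant term. $\beta\mathbb{N}$ is the set of ultrafilters on $\mathbb{N}$, with the Stone topology and the operation: $A\in p+q$ iff $\{x\in\mathbb{N}:-x+A\in q\}\in p$, where $-x+A=\{y\in\mathbb{N}:x+y\in A\}$. An ultrafilter $p$ is idempotent if $p+p=p$; a minimal idempotent is an idempotent lying in $K(\beta\mathbb{N},+)$, the smallest two-sided ideal (the union of all minimal left ideals) of $(\beta\mathbb{N},+)$. A set $A\subseteq\mathbb{N}$ is a $J_p$-set if for every $F\in\mathcal{P}_f(\mathbb{P})$ and every $H\in\mathcal{P}_f(\mathbb{N}^{\mathbb{N}})$ there exist $a\in\mathbb{N}$ and $\beta\in\mathcal{P}_f(\mathbb{N})$ such that $a+P(\sum_{t\in\beta}f(t))\in A$ for all $P\in F$ and $f\in H$. $\mathcal{J}_p=\{q\in\beta\mathbb{N}:\text{every }A\in q\text{ is a }J_p\text{ -set}\}$ (the subscript $p$ stands for "polynomial" and is not an ultrafilter); it is a two-sided ideal of $(\beta\mathbb{N},+)$. Tensor products: for ultrafilters $p_1,\ldots,p_k$ on $\mathbb{N}$, $\bigotimes_{i=1}^k p_i$ is the ultrafilter on $\mathbb{N}^k$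 defined recursively by $\bigotimes_{i=1}^1p_i=p_1$, and, for $A\subseteq\mathbb{N}^{k+1}$, $A\in\bigotimes_{i=1}^{k+1}p_i$ iff $\{(x_1,\ldots,x_k)\in\mathbb{N}^k:\{x_{k+1}\in\mathbb{N}:(x_1,\ldots,x_{k+1})\in A\}\in p_{k+1}\}\in\bigotimes_{i=1}^kp_i$. -}

module Defs where

open import Data.Fin.Base using (Fin; zero; suc; inject₁; fromℕ)
open import Data.Integer.Base as ℤ using (ℤ; +_; 0ℤ)
open import Data.List.Base using (List; []; _∷_)
open import Data.List.NonEmpty as List⁺ using (List⁺; foldr₁)
import Data.List.Membership.Setoid as Membership
import Data.List.Relation.Binary.Subset.Setoid as Subset
import Data.List.Relation.Unary.Unique.Setoid as Uniqueness
open import Data.Nat.Base as ℕ using (ℕ; zero; suc; NonZero)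
open import Data.Product.Base using (Σ; ∃; ∃-syntax; _×_; _,_)
open import Data.Sum.Base using (_⊎_)
open import Data.Vec.Base as Vec using (Vec; []; _∷_; _∷ʳ_)
open import Function.Base using (_∘_; id)
open import Level using (0ℓ) renaming (suc to lsuc)
open import Relation.Binary.Bundles using (Setoid)
open import Relation.Binary.PropositionalEquality
  using (_≡_; refl; sym; trans; setoid; _→-setoid_)
open import Relation.Nullary.Negation using (¬_)
open import Relation.Unary using (Pred; _∈_; _⊆_; _≐_; _∩_; ∁; Satisfiable)

------------------------------------------------------------------------
-- Positive integers

-- The positivity proof is irrelevant, so elements with equal values are
-- propositionally equal.
record ℕ⁺ : Set where
  constructor ⟨_⟩
  field
    value        : ℕ
    .{{nonZero}} : NonZero value

open ℕ⁺ public using (value)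

1⁺ : ℕ⁺
1⁺ = ⟨ 1 ⟩

infixl 6 _+⁺_

_+⁺_ : ℕ⁺ → ℕ⁺ → ℕ⁺
⟨ m ⟩ {{m≢0}} +⁺ ⟨ n ⟩ = ⟨ m ℕ.+ n ⟩ {{pos m m≢0}}
  where
  pos : ∀ a → .(NonZero a) → NonZero (a ℕ.+ n)
  pos (suc a) _ = _

toℤ : ℕ⁺ → ℤ
toℤ n = + value n

ℕ⁺-setoid : Setoid 0ℓ 0ℓ
ℕ⁺-setoid = setoid ℕ⁺

-- ℕ^ℕ; functions are compared pointwise.
ℕ^ℕ : Setoid 0ℓ 0ℓ
ℕ^ℕ = ℕ⁺ →-setoid ℕ⁺

------------------------------------------------------------------------
-- Nonempty finite subsets

-- A nonempty finite set is a nonempty list without repetitions; the order of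
-- the list is forgotten by the equality _≈ᶠ_ below.
record 𝒫f (S : Setoid 0ℓ 0ℓ) : Set where
  field
    elements : List⁺ (Setoid.Carrier S)
    unique   : Uniqueness.Unique S (List⁺.toList elements)

open 𝒫f public using (elements)

module _ {S : Setoid 0ℓ 0ℓ} where

  infix 4 _∈ᶠ_ _⊆ᶠ_ _≈ᶠ_ _⊊_

  _∈ᶠ_ : Setoid.Carrier S → 𝒫f S → Set
  x ∈ᶠ G = Membership._∈_ S x (List⁺.toList (elements G))

  _⊆ᶠ_ : 𝒫f S → 𝒫f S → Set
  G ⊆ᶠ K = Subset._⊆_ S (List⁺.toList (elements G)) (List⁺.toList (elements K))

  _≈ᶠ_ : 𝒫f S → 𝒫f S → Set
  G ≈ᶠ K = (G ⊆ᶠ K) × (K ⊆ᶠ G)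

  _⊊_ : 𝒫f S → 𝒫f S → Set
  G ⊊ K = (G ⊆ᶠ K) × ¬ (G ≈ᶠ K)

𝒫f-setoid : Setoid 0ℓ 0ℓ → Setoid 0ℓ 0ℓ
𝒫f-setoid S = record
  { Carrier       = 𝒫f S
  ; _≈_           = _≈ᶠ_
  ; isEquivalence = record
    { refl  = id , id
    ; sym   = λ (G⊆K , K⊆G) → K⊆G , G⊆K
    ; trans = λ (G⊆K , K⊆G) (K⊆L , L⊆K) →
        (λ x∈G → K⊆L (G⊆K x∈G)) , (λ x∈L → K⊆G (L⊆K x∈L))
    }
  }

max min : 𝒫f ℕ⁺-setoid → ℕ
max β = foldr₁ ℕ._⊔_ (List⁺.map value (elements β))
min β = foldr₁ ℕ._⊓_ (List⁺.map value (elements β))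

infix 4 _<ᶠ_

_<ᶠ_ : 𝒫f ℕ⁺-setoid → 𝒫f ℕ⁺-setoid → Set
β <ᶠ γ = max β ℕ.< min γ

∑ : 𝒫f ℕ⁺-setoid → (ℕ⁺ → ℕ⁺) → ℕ⁺
∑ β f = foldr₁ _+⁺_ (List⁺.map f (elements β))

syntax ∑ β (λ t → e) = ∑[ t ∈ β ] e

------------------------------------------------------------------------
-- Integer polynomials with zero constant term

-- The list c₁ ∷ c₂ ∷ … ∷ c_d ∷ [] stands for c₁x + c₂x² + … + c_d x^d.
Polynomial₀ : Set
Polynomial₀ = List ℤ

-- coeff P n is the coefficient of x^(n+1).
coeff : Polynomial₀ → ℕ → ℤ
coeff []       _       = 0ℤ
coeff (c ∷ cs) zero    = c
coeff (c ∷ cs) (suc n) = coeff cs n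

eval : Polynomial₀ → ℤ → ℤ
eval []       x = 0ℤ
eval (c ∷ cs) x = x ℤ.* (c ℤ.+ eval cs x)

-- Comparing coefficients identifies lists that differ by trailing zeros.
ℙ : Setoid 0ℓ 0ℓ
ℙ = record
  { Carrier       = Polynomial₀
  ; _≈_           = λ P Q → ∀ n → coeff P n ≡ coeff Q n
  ; isEquivalence = record
    { refl  = λ _ → refl
    ; sym   = λ P≈Q n → sym (P≈Q n)
    ; trans = λ P≈Q Q≈R n → trans (P≈Q n) (Q≈R n)
    }
  }

------------------------------------------------------------------------
-- Ultrafilters

-- That ∅ is not a member is stated positively (every member has an element).
-- The constructively weaker ¬ (∅ ∈ members) is classically equivalent.  The
-- whole set is a member by ultra and upward.
record Ultrafilter (X : Set) : Set₁ where
  field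
    members   : Pred (Pred X 0ℓ) 0ℓ
    inhabited : ∀ {A} → A ∈ members → Satisfiable A
    upward    : ∀ {A B} → A ⊆ B → A ∈ members → B ∈ members
    ∩-closed  : ∀ {A B} → A ∈ members → B ∈ members → A ∩ B ∈ members
    ultra     : ∀ A → A ∈ members ⊎ ∁ A ∈ members

open Ultrafilter public using (members)

infix 4 _≈ᵤ_

_≈ᵤ_ : {X : Set} → Ultrafilter X → Ultrafilter X → Set₁
p ≈ᵤ q = members p ≐ members q

-- A ∈ lim p q  iff  {x : A ∈ q x} ∈ p.
lim : {X Y : Set} → Ultrafilter X → (X → Ultrafilter Y) → Ultrafilter Y
lim {X} {Y} p q = record
  { members   = λ A → (λ x → A ∈ members (q x)) ∈ members p
  ; inhabited = λ m → let x , A∈qx = P.inhabited m in Q.inhabited x A∈qx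
  ; upward    = λ A⊆B → P.upward (λ {x} → Q.upward x A⊆B)
  ; ∩-closed  = λ m n → P.upward (λ {x} (a , b) → Q.∩-closed x a b) (P.∩-closed m n)
  ; ultra     = ultra′
  }
  where
  module P = Ultrafilter p
  module Q (x : X) = Ultrafilter (q x)
  open import Data.Sum.Base using (inj₁; inj₂)
  open import Data.Empty using (⊥-elim)

  ultra′ : ∀ A → (λ x → A ∈ members (q x)) ∈ members p
               ⊎ (λ x → ∁ A ∈ members (q x)) ∈ members p
  ultra′ A with P.ultra (λ x → A ∈ members (q x))
  ... | inj₁ m = inj₁ m
  ... | inj₂ m = inj₂ (P.upward (λ {x} → other x) m)
    where
    other : ∀ x → ¬ (A ∈ members (q x)) → ∁ A ∈ members (q x)
    other x A∉qx with Q.ultra x A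
    ... | inj₁ A∈qx  = ⊥-elim (A∉qx A∈qx)
    ... | inj₂ ∁A∈qx = ∁A∈qx

-- A ∈ image g p  iff  {x : g x ∈ A} ∈ p.
image : {X Y : Set} → (X → Y) → Ultrafilter X → Ultrafilter Y
image g p = record
  { members   = λ A → (A ∘ g) ∈ members p
  ; inhabited = λ m → let x , a = P.inhabited m in g x , a
  ; upward    = λ A⊆B → P.upward A⊆B
  ; ∩-closed  = P.∩-closed
  ; ultra     = λ A → P.ultra (A ∘ g)
  }
  where module P = Ultrafilter p

βℕ : Set₁
βℕ = Ultrafilter ℕ⁺

infixl 6 _+ᵤ_

-- Membership unfolds definitionally to:
-- A ∈ p + q  iff  {x : {y : x + y ∈ A} ∈ q} ∈ p.
_+ᵤ_ : βℕ → βℕ → βℕ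
p +ᵤ q = lim p (λ x → image (x +⁺_) q)

-- ⨂ k p is the tensor product of the k + 1 ultrafilters p 0, …, p k.
-- Membership unfolds definitionally to:
-- A ∈ ⨂ (k + 1) p  iff
-- {(x₀,…,x_k) : {y : (x₀,…,x_k,y) ∈ A} ∈ p (k + 1)} ∈ ⨂ k (p 0,…,p k).
⨂ : ∀ k → (Fin (suc k) → βℕ) → Ultrafilter (Vec ℕ⁺ (suc k))
⨂ zero    p = image (_∷ []) (p zero)
⨂ (suc k) p = lim (⨂ k (p ∘ inject₁)) (λ xs → image (xs ∷ʳ_) (p (fromℕ (suc k))))

Idempotent : βℕ → Set₁
Idempotent p = p +ᵤ p ≈ᵤ p

-- Subsets of βℕ range over Pred βℕ (lsuc 0ℓ), a level that contains the
-- principal left ideals {r : ∃ q, r ≈ᵤ q + p}.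
record LeftIdeal (L : Pred βℕ (lsuc 0ℓ)) : Set₁ where
  field
    respects : ∀ {p q} → p ≈ᵤ q → p ∈ L → q ∈ L
    nonempty : Satisfiable L
    absorbs  : ∀ p {q} → q ∈ L → p +ᵤ q ∈ L

MinimalLeftIdeal : Pred βℕ (lsuc 0ℓ) → Set₂
MinimalLeftIdeal L = LeftIdeal L × (∀ L′ → LeftIdeal L′ → L′ ⊆ L → L ⊆ L′)

Kβℕ : Pred βℕ (lsuc (lsuc 0ℓ))
Kβℕ p = ∃[ L ] MinimalLeftIdeal L × p ∈ L

MinimalIdempotent : βℕ → Set₂
MinimalIdempotent p = Idempotent p × p ∈ Kβℕ

------------------------------------------------------------------------
-- Polynomial J-sets

infix 4 _∈ℤ_ _∈ℤⁿ_

-- Membership of an integer, or of a tuple of integers, in a set of positive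
-- integers, or of tuples of positive integers.
_∈ℤ_ : ℤ → Pred ℕ⁺ 0ℓ → Set
z ∈ℤ A = ∃[ x ] x ∈ A × toℤ x ≡ z

_∈ℤⁿ_ : ∀ {n} → Vec ℤ n → Pred (Vec ℕ⁺ n) 0ℓ → Set
zs ∈ℤⁿ A = ∃[ xs ] xs ∈ A × Vec.map toℤ xs ≡ zs

Jₚ-set : Pred ℕ⁺ 0ℓ → Set
Jₚ-set A = (F : 𝒫f ℙ) (H : 𝒫f ℕ^ℕ) →
  ∃[ a ] Σ (𝒫f ℕ⁺-setoid) λ β →
    ∀ P f → P ∈ᶠ F → f ∈ᶠ H →
      toℤ a ℤ.+ eval P (toℤ (∑[ t ∈ β ] f t)) ∈ℤ A

𝒥ₚ : Pred βℕ (lsuc 0ℓ)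
𝒥ₚ q = ∀ A → A ∈ members q → Jₚ-set A

{-# OPTIONS --safe #-}

-- For one idempotent p in 𝒥ₚ, the values α(G) and H(G) are chosen by recursion on
-- ⊊.  Below G only finitely many pairs (s , u) of partial sums occur, each with
-- s + P(u) in A⋆ = {x ∈ A : -x + A ∈ p}.  As
-- P(u + v) = P(u) + (polynomial in v without constant term), applying the Jₚ
-- property of A⋆ ∩ ⋂ (-(s + P(u)) + A⋆) to the finitely many translated
-- polynomials yields a and β by which every chain can be continued.  For a tensor
-- product the sets A depend on the finitely many tuples already produced, and one
-- inducts on the number of factors.
--
-- Minimal idempotents lie in 𝒥ₚ: if A ∈ p, then {y : -y + A ∈ p} is syndetic, so
-- translates of members of p behave like open sets of a minimal system, in which
-- polynomial recurrence along sums over finite sets follows by PET induction with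
-- colour focusing.
--
-- Excluded middle (for types in Set) is read off from an ultrafilter.

module Submission where

open import Defs
open import Data.Empty using (⊥-elim)
open import Data.Fin.Base using (Fin; zero; suc; inject₁; fromℕ; toℕ)
import Data.Fin.Properties as Fin
open import Data.Integer.Base using (ℤ; +_; -[1+_]; 0ℤ; -_; _+_; _-_; _*_; ∣_∣)
import Data.Integer.Properties as ℤ
import Data.Integer.Tactic.RingSolver as ℤ-Solver
open import Data.List.Base
  using (List; []; _∷_; _++_; length; map; replicate; filter; deduplicate; concatMap; upTo;
         cartesianProduct; cartesianProductWith)
import Data.List.Membership.Propositional.Properties as ∈ₚ
open import Data.List.Membership.Propositional using (find) renaming (_∈_ to _∈ˡ_)
import Data.List.Membership.Setoid as Membership
import Data.List.Membership.Setoid.Properties as ∈ₛ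
open import Data.List.NonEmpty.Base as List⁺ using (List⁺; foldr₁; _∷_)
import Data.List.Properties as List
open import Data.List.Relation.Binary.Permutation.Propositional using (_↭_; ↭-sym; ↭⇒↭ₛ)
import Data.List.Relation.Binary.Permutation.Propositional.Properties as ↭
import Data.List.Relation.Binary.Permutation.Setoid.Properties as ↭ₛ
open import Data.List.Relation.Unary.All as All using (All; []; _∷_)
import Data.List.Relation.Unary.All.Properties as All
open import Data.List.Relation.Unary.AllPairs using ([]; _∷_)
open import Data.List.Relation.Unary.Any as Any using (Any; here; there)
import Data.List.Relation.Unary.Any.Properties as Any
open import Data.List.Relation.Unary.Linked using (Linked; []; [-]; _∷_)
import Data.List.Relation.Unary.Unique.DecSetoid.Properties as Uniqueness
open import Data.List.Relation.Unary.Unique.Propositional using (Unique)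
import Data.List.Relation.Unary.Unique.Setoid as Uniqueness
import Data.List.Relation.Unary.Unique.Setoid.Properties as Uniqueness
import Data.List.Sort as Sort
open import Data.Nat.Base as ℕ using (ℕ; zero; suc; _≤_; _<_; z≤n; s≤s)
open import Data.Nat.Induction using (<-wellFounded; <-rec)
open import Data.Nat.ListAction using (sum)
open import Data.Nat.ListAction.Properties using (sum-↭)
import Data.Nat.Properties as ℕ
open import Data.Product.Base using (Σ; ∃; ∃₂; ∃-syntax; _×_; _,_; proj₁; proj₂; map₂)
open import Data.Sum.Base as Sum using (_⊎_; inj₁; inj₂)
open import Data.Unit.Base using (⊤; tt)
open import Data.Vec.Base as Vec using (Vec; []; _∷_; _∷ʳ_; tabulate)
import Data.Vec.Properties as Vec
open import Function.Base using (_∘_; id; case_of_)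
open import Function.Bundles using (_⟶ₛ_; _⟨$⟩_)
import Induction.WellFounded as WF
open import Level using (0ℓ) renaming (suc to lsuc)
open import Relation.Binary.Bundles using (Setoid; DecSetoid)
import Relation.Binary.Construct.Flip.EqAndOrd as Flip
import Relation.Binary.Construct.On as On
open import Relation.Binary.PropositionalEquality
  using (_≡_; _≢_; _≗_; refl; sym; trans; cong; cong₂; subst; setoid; module ≡-Reasoning)
open import Relation.Nullary.Decidable using (Dec; yes; no; decidable-stable; ¬?)
open import Relation.Nullary.Negation using (¬_; contradiction)
open import Relation.Unary using (Pred; _∈_; _⊆_; _≐_)

-- Lists

upperBound : ∀ {Y : Set} (f : Y → ℕ) ys → ∃[ M ] ∀ {y} → y ∈ˡ ys → f y ≤ M
upperBound f []       = 0 , λ ()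
upperBound f (y ∷ ys) with M , bound ← upperBound f ys = f y ℕ.⊔ M , λ where
  (here refl) → ℕ.m≤m⊔n _ _
  (there y∈)  → ℕ.≤-trans (bound y∈) (ℕ.m≤n⊔m _ _)

module SetoidLists (S : Setoid 0ℓ 0ℓ) where

  open Setoid S renaming (Carrier to X; refl to ≈-refl; sym to ≈-sym; trans to ≈-trans)
  open Membership S using () renaming (_∈_ to _∈ₗ_)

  ∈-remove : ∀ {x xs} → x ∈ₗ xs →
             ∃[ ys ] length xs ≡ suc (length ys) × (∀ {y} → y ∈ₗ xs → y ≈ x ⊎ y ∈ₗ ys)
  ∈-remove (here {xs = xs} x≈z) = xs , refl , λ
    { (here y≈z) → inj₁ (≈-trans y≈z (≈-sym x≈z)) ; (there y∈) → inj₂ y∈ }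
  ∈-remove (there {x = z} x∈xs) with ys , eq , split ← ∈-remove x∈xs =
    z ∷ ys , cong suc eq , λ { (here y≈z) → inj₂ (here y≈z) ; (there y∈) → Sum.map₂ there (split y∈) }

  Unique-⊆⇒length≤ : ∀ {xs ys} → Uniqueness.Unique S xs → (∀ {x} → x ∈ₗ xs → x ∈ₗ ys) →
                     length xs ≤ length ys
  Unique-⊆⇒length≤ []         _  = z≤n
  Unique-⊆⇒length≤ {x ∷ xs} {ys} (x∉xs ∷ xs!) ⊆ys
    with zs , eq , split ← ∈-remove (⊆ys (here ≈-refl)) =
    subst (suc (length xs) ≤_) (sym eq) (s≤s (Unique-⊆⇒length≤ xs! ⊆zs))
    where
    ⊆zs : ∀ {y} → y ∈ₗ xs → y ∈ₗ zs
    ⊆zs y∈xs with split (⊆ys (there y∈xs))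
    ... | inj₂ y∈zs = y∈zs
    ... | inj₁ y≈x  = ⊥-elim (All.All¬⇒¬Any x∉xs (Any.map (≈-trans (≈-sym y≈x)) y∈xs))

-- Polynomial set maps

SetMap : Set
SetMap = List ℕ⁺ → ℤ

Δ : List ℕ⁺ → SetMap → SetMap
Δ u φ v = φ (u ++ v) - φ u - φ v

data Deg≤ : ℕ → SetMap → Set where
  zero : ∀ {φ} → (∀ u → φ u ≡ 0ℤ) → Deg≤ zero φ
  suc  : ∀ {d φ} → (∀ u → Deg≤ d (Δ u φ)) → Deg≤ (suc d) φ

Deg≤-cong : ∀ {d φ ψ} → φ ≗ ψ → Deg≤ d φ → Deg≤ d ψ
Deg≤-cong φ≗ψ (zero φ≡0) = zero λ u → trans (sym (φ≗ψ u)) (φ≡0 u)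
Deg≤-cong φ≗ψ (suc Δφ)   = suc λ u → Deg≤-cong
  (λ v → cong₂ _-_ (cong₂ _-_ (φ≗ψ (u ++ v)) (φ≗ψ u)) (φ≗ψ v)) (Δφ u)

Deg≤-+ : ∀ {d φ ψ} → Deg≤ d φ → Deg≤ d ψ → Deg≤ d (λ v → φ v + ψ v)
Deg≤-+ (zero φ≡0) (zero ψ≡0) = zero λ u → cong₂ _+_ (φ≡0 u) (ψ≡0 u)
Deg≤-+ {φ = φ} {ψ} (suc Δφ) (suc Δψ) = suc λ u → Deg≤-cong
  (λ v → interchange (φ (u ++ v)) (φ u) (φ v) (ψ (u ++ v)) (ψ u) (ψ v))
  (Deg≤-+ (Δφ u) (Δψ u))
  where
  interchange : ∀ a b c a′ b′ c′ →
    (a - b - c) + (a′ - b′ - c′) ≡ (a + a′) - (b + b′) - (c + c′)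
  interchange = ℤ-Solver.solve-∀

Deg≤-neg : ∀ {d φ} → Deg≤ d φ → Deg≤ d (λ v → - φ v)
Deg≤-neg (zero φ≡0) = zero λ u → cong -_ (φ≡0 u)
Deg≤-neg {φ = φ} (suc Δφ) = suc λ u → Deg≤-cong
  (λ v → neg-distrib (φ (u ++ v)) (φ u) (φ v)) (Deg≤-neg (Δφ u))
  where
  neg-distrib : ∀ a b c → - (a - b - c) ≡ - a - (- b) - (- c)
  neg-distrib = ℤ-Solver.solve-∀

Deg≤-suc : ∀ {d φ} → Deg≤ d φ → Deg≤ (suc d) φ
Deg≤-suc (zero φ≡0) = suc λ u → zero λ v →
  cong₂ _-_ (cong₂ _-_ (φ≡0 (u ++ v)) (φ≡0 u)) (φ≡0 v)
Deg≤-suc (suc Δφ)   = suc λ u → Deg≤-suc (Δφ u)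

Deg≤-mono : ∀ {d e φ} → d ≤ e → Deg≤ d φ → Deg≤ e φ
Deg≤-mono {e = zero}  _         (zero φ≡0) = zero φ≡0
Deg≤-mono {e = suc e} _         (zero φ≡0) = Deg≤-suc (Deg≤-mono {e = e} z≤n (zero φ≡0))
Deg≤-mono             (s≤s d≤e) (suc Δφ)   = suc λ u → Deg≤-mono d≤e (Δφ u)

Deg≤-[] : ∀ {d φ} → Deg≤ d φ → φ [] ≡ 0ℤ
Deg≤-[] (zero φ≡0) = φ≡0 []
Deg≤-[] {φ = φ} (suc Δφ) = trans (cancel (φ [])) (cong -_ (Deg≤-[] (Δφ [])))
  where
  cancel : ∀ a → a ≡ - (a - a - a)
  cancel = ℤ-Solver.solve-∀

-- In Increasing M β N, N is the last entry of β, or M if β is empty.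
data Increasing : ℕ → List ℕ⁺ → ℕ → Set where
  []  : ∀ {M} → Increasing M [] M
  _∷_ : ∀ {M N t β} → M < value t → Increasing (value t) β N → Increasing M (t ∷ β) N

Increasing-++ : ∀ {L M N u v} → Increasing L u M → Increasing M v N → Increasing L (u ++ v) N
Increasing-++ []          incv = incv
Increasing-++ (l<t ∷ inc) incv = l<t ∷ Increasing-++ inc incv

-- A coset of the set maps of degree at most d inside those of degree at most
-- d + 1; it consists of the set maps with a prescribed leading term.
record Class : Set where
  field
    degree   : ℕ
    rep      : SetMap
    rep-deg  : Deg≤ (suc degree) rep

open Class

infix 4 _∈ᶜ_

record _∈ᶜ_ (φ : SetMap) (c : Class) : Set where
  constructor coset
  field
    difference : Deg≤ (degree c) (λ v → φ v - rep c v)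

∈ᶜ⇒Deg≤ : ∀ {φ c} → φ ∈ᶜ c → Deg≤ (suc (degree c)) φ
∈ᶜ⇒Deg≤ {φ} {c} (coset φ-c) = Deg≤-cong (λ v → cancel (φ v) (rep c v))
  (Deg≤-+ (Deg≤-suc φ-c) (rep-deg c))
  where
  cancel : ∀ a b → (a - b) + b ≡ a
  cancel = ℤ-Solver.solve-∀

singletonClass : ∀ d φ → Deg≤ (suc d) φ → Σ Class λ c → degree c ≡ d × φ ∈ᶜ c
singletonClass d φ deg =
  record { degree = d ; rep = φ ; rep-deg = deg } , refl ,
  coset (Deg≤-mono z≤n (zero λ v → ℤ.+-inverseʳ (φ v)))

derive : SetMap → SetMap → List ℕ⁺ → SetMap
derive g φ u v = φ (u ++ v) - φ u - g v

subClass : ∀ {i} g → Deg≤ (suc i) g → (c : Class) → i ≤ degree c → Class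
subClass g g-deg c i≤d = record
  { degree  = degree c
  ; rep     = λ v → rep c v + - g v
  ; rep-deg = Deg≤-+ (rep-deg c) (Deg≤-neg (Deg≤-mono (s≤s i≤d) g-deg))
  }

Δ-deg : ∀ {d φ} → Deg≤ (suc d) φ → ∀ u → Deg≤ d (Δ u φ)
Δ-deg (suc Δφ) = Δφ

derive-∈-subClass : ∀ {i g} {g-deg : Deg≤ (suc i) g} {c φ} {i≤d : i ≤ degree c} → φ ∈ᶜ c →
                    ∀ u → derive g φ u ∈ᶜ subClass g g-deg c i≤d
derive-∈-subClass {g = g} {c = c} {φ} φ∈c u = coset (Deg≤-cong
  (λ v → rearrange (φ (u ++ v)) (φ u) (φ v) (rep c v) (g v))
  (Deg≤-+ (Δ-deg (∈ᶜ⇒Deg≤ φ∈c) u) (_∈ᶜ_.difference φ∈c)))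
  where
  rearrange : ∀ a b x y z → (a - b - x) + (x - y) ≡ (a - b - z) - (y - z)
  rearrange = ℤ-Solver.solve-∀

derive-∈-rep : ∀ {c φ} → φ ∈ᶜ c → ∀ u → Deg≤ (degree c) (derive (rep c) φ u)
derive-∈-rep {c} {φ} φ∈c u = Deg≤-cong
  (λ v → rearrange (φ (u ++ v)) (φ u) (φ v) (rep c v))
  (Deg≤-+ (Δ-deg (∈ᶜ⇒Deg≤ φ∈c) u) (_∈ᶜ_.difference φ∈c))
  where
  rearrange : ∀ a b x y → (a - b - x) + (x - y) ≡ a - b - y
  rearrange = ℤ-Solver.solve-∀

-- Large plays the role of the nonempty open sets of a minimal system: finitely
-- many translates of a large set meet every large set in a large set.
module PET
  (Large   : Pred (Pred ℤ 0ℓ) 0ℓ)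
  (upward  : ∀ {U V : Pred ℤ 0ℓ} → U ⊆ V → Large U → Large V)
  (shift   : ∀ U y → Large U → Large (λ z → U (z + y)))
  (minimal : ∀ U → Large U → ∃[ X ] ∀ {W} → Large W → ∃[ x ] x ∈ˡ X × Large (λ z → W z × U (z + x)))
  where

  Recurrent : List SetMap → Set₁
  Recurrent 𝓕 = ∀ {U} → Large U → ∀ M → ∃₂ λ β N → Increasing M β N × β ≢ [] ×
    Large (λ z → U z × ∀ φ → φ ∈ˡ 𝓕 → U (z + φ β))

  module Focus (𝓕 : List SetMap) (g : SetMap) (φ[]≡0 : ∀ {φ} → φ ∈ˡ 𝓕 → φ [] ≡ 0ℤ)
               (recurrent : ∀ us → Recurrent (cartesianProductWith (derive g) 𝓕 us))
               {U} (U-large : Large U) (M : ℕ) where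

    X : List ℤ
    X = proj₁ (minimal _ U-large)

    Return : Set
    Return = ∃₂ λ β N → Increasing M β N × β ≢ [] × Large (λ z → U z × ∀ φ → φ ∈ˡ 𝓕 → U (z + φ β))

    -- Colour focusing: the points of W see the colour x along the tail u of the
    -- blocks chosen so far, for every (x , u) in the history.  As long as the
    -- colours are new, the recurrence of the derived family supplies a further
    -- block; a repeated colour gives the required return.
    record State (unused : List ℤ) : Set₁ where
      field
        history : List (ℤ × List ℕ⁺)
        colours : ∀ {x} → x ∈ˡ X → x ∈ˡ unused ⊎ ∃[ u ] (x , u) ∈ˡ history
        K       : ℕ
        M≤K     : M ≤ K
        blocks  : ∀ {x u} → (x , u) ∈ˡ history → u ≢ [] × Increasing M u K
        W       : Pred ℤ 0ℓ
        W-large : Large W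
        seen    : ∀ {z x u φ} → W z → (x , u) ∈ˡ history → φ ∈ˡ 𝓕 → U (z + φ u + x)

    ++-≢[] : ∀ {u v : List ℕ⁺} → u ≢ [] → u ++ v ≢ []
    ++-≢[] {[]}    u≢[] _ = u≢[] refl
    ++-≢[] {_ ∷ _} _ ()

    Increasing-≤ : ∀ {M u N} → u ≢ [] → Increasing M u N → M ≤ N
    Increasing-≤ u≢[] []          = contradiction refl u≢[]
    Increasing-≤ u≢[] (M<t ∷ [])  = ℕ.<⇒≤ M<t
    Increasing-≤ u≢[] (M<t ∷ inc@(_ ∷ _)) = ℕ.≤-trans (ℕ.<⇒≤ M<t) (Increasing-≤ (λ ()) inc)

    Increasing-weaken : ∀ {L M u N} → L ≤ M → u ≢ [] → Increasing M u N → Increasing L u N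
    Increasing-weaken L≤M u≢[] []          = contradiction refl u≢[]
    Increasing-weaken L≤M u≢[] (M<t ∷ inc) = ℕ.≤-<-trans L≤M M<t ∷ inc

    step : ∀ {unused} → State unused →
           Return ⊎ ∃[ unused′ ] length unused ≡ suc (length unused′) × State unused′
    step {unused} state = result
      where
      open State state

      result : Return ⊎ ∃[ unused′ ] length unused ≡ suc (length unused′) × State unused′
      result with x , x∈X , W′-large ← proj₂ (minimal _ U-large) W-large
        with colours x∈X
      ... | inj₂ (u , xu∈) = inj₁ (u , K , proj₂ (blocks xu∈) , proj₁ (blocks xu∈) ,
        upward (λ {z} (w , uz) →
            subst U (cancel z x) uz ,
            λ φ φ∈ → subst U (rearrange z x (φ u)) (seen w xu∈ φ∈))
          (shift _ (- x) W′-large))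
        where
        cancel : ∀ z x → z - x + x ≡ z
        cancel = ℤ-Solver.solve-∀
        rearrange : ∀ z x y → z - x + y + x ≡ z + y
        rearrange = ℤ-Solver.solve-∀
      ... | inj₁ x∈unused
        with unused′ , len , split ← SetoidLists.∈-remove (setoid ℤ) x∈unused
        with v , N , v-inc , v≢[] , W″-large ←
          recurrent ([] ∷ map proj₂ history) W′-large K =
        inj₂ (unused′ , len , record
          { history = history″
          ; colours = colours″
          ; K       = N
          ; M≤K     = ℕ.≤-trans M≤K (Increasing-≤ v≢[] v-inc)
          ; blocks  = blocks″
          ; W       = _
          ; W-large = shift _ (g v) W″-large
          ; seen    = λ {z} → seen″ {z}
          })
        where
        history′ history″ : List (ℤ × List ℕ⁺)
        history′ = (x , []) ∷ history
        history″ = map (λ (y , u) → y , u ++ v) history′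

        colours″ : ∀ {y} → y ∈ˡ X → y ∈ˡ unused′ ⊎ ∃[ u ] (y , u) ∈ˡ history″
        colours″ y∈X with colours y∈X
        ... | inj₂ (u , yu∈) = inj₂ (u ++ v , there (∈ₚ.∈-map⁺ _ yu∈))
        ... | inj₁ y∈unused with split y∈unused
        ...   | inj₁ refl = inj₂ (v , here refl)
        ...   | inj₂ y∈   = inj₁ y∈

        blocks″ : ∀ {y u} → (y , u) ∈ˡ history″ → u ≢ [] × Increasing M u N
        blocks″ (here refl) = v≢[] , Increasing-weaken M≤K v≢[] v-inc
        blocks″ (there yu∈) with (_ , u) , yu∈history , refl ← ∈ₚ.∈-map⁻ _ yu∈ =
          ++-≢[] (proj₁ (blocks yu∈history)) , Increasing-++ (proj₂ (blocks yu∈history)) v-inc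

        W′ : Pred ℤ 0ℓ
        W′ z = W z × U (z + x)

        seen′ : ∀ {z y u φ} → W′ z → (y , u) ∈ˡ history′ → φ ∈ˡ 𝓕 → U (z + φ u + y)
        seen′ {z} (_ , uz) (here refl) φ∈ =
          subst (λ e → U (e + x)) (sym (trans (cong (_+_ z) (φ[]≡0 φ∈)) (ℤ.+-identityʳ z))) uz
        seen′ (w , _) (there yu∈) φ∈ = seen w yu∈ φ∈

        ∈-us : ∀ {y u} → (y , u) ∈ˡ history′ → u ∈ˡ [] ∷ map proj₂ history
        ∈-us = ∈ₚ.∈-map⁺ proj₂

        seen″ : ∀ {z y u φ} →
          W′ (z + g v) × (∀ ψ → ψ ∈ˡ cartesianProductWith (derive g) 𝓕 ([] ∷ map proj₂ history) →
                            W′ (z + g v + ψ v)) →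
          (y , u) ∈ˡ history″ → φ ∈ˡ 𝓕 → U (z + φ u + y)
        seen″ {z} {y} {φ = φ} (_ , returns) yu∈ φ∈
          with (_ , u) , yu∈′ , refl ← ∈ₚ.∈-map⁻ (λ (y , u) → y , u ++ v) {xs = history′} yu∈ =
          subst (λ e → U (e + y)) (rearrange z (g v) (φ (u ++ v)) (φ u))
            (seen′ {z = z + g v + (φ (u ++ v) - φ u - g v)} 
              (returns _ (∈ₚ.∈-cartesianProductWith⁺ (derive g) φ∈ (∈-us yu∈′))) yu∈′ φ∈)
          where
          rearrange : ∀ z b c d → z + b + (c - d - b) + d ≡ z + c
          rearrange = ℤ-Solver.solve-∀

    run : ∀ n {unused} → length unused ≡ n → State unused → Return
    run n len state with step state
    run n       len state | inj₁ return = return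
    run zero    len state | inj₂ (_ , len′ , _) with () ← trans (sym len) len′
    run (suc n) len state | inj₂ (_ , len′ , state′) =
      run n (ℕ.suc-injective (trans (sym len′) len)) state′

    return : Return
    return = run (length X) refl record
      { history = []
      ; colours = inj₁
      ; K       = M
      ; M≤K     = ℕ.≤-refl
      ; blocks  = λ ()
      ; W       = U
      ; W-large = U-large
      ; seen    = λ _ ()
      }

  WeightRecurrent : List ℕ → Set₁
  WeightRecurrent ds = ∀ cs → map degree cs ≡ ds → ∀ 𝓕 → All (λ φ → Any (φ ∈ᶜ_) cs) 𝓕 → Recurrent 𝓕

  recurrent-⊆ : ∀ {𝓕 𝓖} → (∀ {φ} → φ ∈ˡ 𝓕 → Deg≤ zero φ ⊎ φ ∈ˡ 𝓖) → Recurrent 𝓖 → Recurrent 𝓕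
  recurrent-⊆ {𝓕} {𝓖} split rec {U} U-large M with β , N , inc , β≢[] , large ← rec U-large M =
    β , N , inc , β≢[] , upward (λ (u , returns) → u , λ φ φ∈ → go u returns (split φ∈)) large
    where
    go : ∀ {z φ} → U z → (∀ φ → φ ∈ˡ 𝓖 → U (z + φ β)) → Deg≤ zero φ ⊎ φ ∈ˡ 𝓖 → U (z + φ β)
    go {z} u _ (inj₁ (zero φ≡0)) = subst U (sym (trans (cong (_+_ z) (φ≡0 β)) (ℤ.+-identityʳ z))) u
    go _ returns (inj₂ φ∈) = returns _ φ∈

  weight-[] : WeightRecurrent []
  weight-[] [] _ [] _ {U} U-large M =
    ⟨ suc M ⟩ ∷ [] , suc M , ℕ.≤-refl ∷ [] , (λ ()) , upward (λ u → u , λ _ ()) U-large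
  weight-[] [] _ (_ ∷ _) (() ∷ _)

  subClasses : ∀ {i} g → Deg≤ (suc i) g → (cs : List Class) → All (λ d → i ≤ d) (map degree cs) →
    ∃[ cs′ ] map degree cs′ ≡ map degree cs ×
      (∀ {φ} u → Any (φ ∈ᶜ_) cs → Any (derive g φ u ∈ᶜ_) cs′)
  subClasses g g-deg []       _            = [] , refl , λ _ ()
  subClasses g g-deg (c ∷ cs) (i≤d ∷ i≤ds) with cs′ , eq , cover ← subClasses g g-deg cs i≤ds =
    subClass g g-deg c i≤d ∷ cs′ , cong (degree c ∷_) eq , λ where
      u (here φ∈c) → here (derive-∈-subClass {g-deg = g-deg} {i≤d = i≤d} φ∈c u)
      u (there φ∈) → there (cover u φ∈)

  splitZero : ∀ {P : Pred SetMap 0ℓ} 𝓕 → (∀ {φ} → φ ∈ˡ 𝓕 → Deg≤ zero φ ⊎ P φ) →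
    ∃[ 𝓖 ] All P 𝓖 × (∀ {φ} → φ ∈ˡ 𝓕 → Deg≤ zero φ ⊎ φ ∈ˡ 𝓖)
  splitZero [] _ = [] , [] , λ ()
  splitZero (φ ∷ 𝓕) h with 𝓖 , all , split ← splitZero 𝓕 (h ∘ there) with h (here refl)
  ... | inj₁ φ≡0 = 𝓖 , all , λ { (here refl) → inj₁ φ≡0 ; (there φ∈) → split φ∈ }
  ... | inj₂ pφ  = φ ∷ 𝓖 , pφ ∷ all , λ where
    (here refl) → inj₂ (here refl)
    (there φ∈)  → Sum.map₂ there (split φ∈)

  lowerClasses : ∀ j 𝓕 cs → (∀ {φ} → φ ∈ˡ 𝓕 → Deg≤ (suc j) φ ⊎ Any (φ ∈ᶜ_) cs) →
    ∃₂ λ n cs′ → map degree cs′ ≡ replicate n j ++ map degree cs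
      × (∀ {φ} → Any (φ ∈ᶜ_) cs → Any (φ ∈ᶜ_) cs′) × All (λ φ → Any (φ ∈ᶜ_) cs′) 𝓕
  lowerClasses j []      cs _ = 0 , cs , refl , id , []
  lowerClasses j (φ ∷ 𝓕) cs h
    with n , cs′ , eq , embed , all ← lowerClasses j 𝓕 cs (h ∘ there)
    with h (here refl)
  ... | inj₂ φ∈cs = n , cs′ , eq , embed , embed φ∈cs ∷ all
  ... | inj₁ deg with c , refl , φ∈c ← singletonClass j φ deg =
    suc n , c ∷ cs′ , cong (j ∷_) eq , there ∘ embed , here φ∈c ∷ All.map there all

  private
    module Derived {ds} (c : Class) (i≤ds : All (degree c ≤_) ds)
                   (cs : List Class) (degs : map degree cs ≡ ds) (𝓕 : List SetMap)
                   (all : All (λ φ → Any (φ ∈ᶜ_) (c ∷ cs)) 𝓕) where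

      sub : ∃[ cs′ ] map degree cs′ ≡ map degree cs ×
              (∀ {φ} u → Any (φ ∈ᶜ_) cs → Any (derive (rep c) φ u ∈ᶜ_) cs′)
      sub = subClasses (rep c) (rep-deg c) cs (subst (All (degree c ≤_)) (sym degs) i≤ds)

      cs′ : List Class
      cs′ = proj₁ sub

      degs′ : map degree cs′ ≡ ds
      degs′ = trans (proj₁ (proj₂ sub)) degs

      derived : ∀ us {ψ} → ψ ∈ˡ cartesianProductWith (derive (rep c)) 𝓕 us →
                Deg≤ (degree c) ψ ⊎ Any (ψ ∈ᶜ_) cs′
      derived us ψ∈ with φ , u , φ∈ , _ , refl ← ∈ₚ.∈-cartesianProductWith⁻ (derive (rep c)) 𝓕 us ψ∈
        with All.lookup all φ∈
      ... | here φ∈c   = inj₁ (derive-∈-rep φ∈c u)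
      ... | there φ∈cs = inj₂ (proj₂ (proj₂ sub) u φ∈cs)

      zero-at-[] : ∀ {φ} → φ ∈ˡ 𝓕 → φ [] ≡ 0ℤ
      zero-at-[] φ∈ with c′ , φ∈c′ ← Any.satisfied (All.lookup all φ∈) =
        Deg≤-[] (∈ᶜ⇒Deg≤ φ∈c′)

  -- Subtracting the representative of a class of least degree turns that class
  -- into an unbounded number of classes of the next lower degree and keeps the
  -- degrees of all others, so the weight is a list of degrees and the induction
  -- is on the least of them.
  weight-∷         : ∀ i {ds} → All (i ≤_) ds → WeightRecurrent ds → WeightRecurrent (i ∷ ds)
  weight-replicate : ∀ n i {ds} → All (i ≤_) ds → WeightRecurrent ds → WeightRecurrent (replicate n i ++ ds)

  weight-∷ zero i≤ds rec (c ∷ cs) refl 𝓕 all U-large M =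
    Focus.return 𝓕 (rep c) D.zero-at-[]
      (λ us → let 𝓖 , 𝓖-all , split = splitZero (cartesianProductWith (derive (rep c)) 𝓕 us) (D.derived us)
              in recurrent-⊆ split (rec D.cs′ D.degs′ 𝓖 𝓖-all))
      U-large M
    where
    module D = Derived c i≤ds cs refl 𝓕 all
  weight-∷ (suc j) i≤ds rec (c ∷ cs) refl 𝓕 all U-large M =
    Focus.return 𝓕 (rep c) D.zero-at-[]
      (λ us → let n , cs″ , degs″ , _ , all″ = lowerClasses j _ D.cs′ (D.derived us)
              in weight-replicate n j (All.map ℕ.<⇒≤ i≤ds) rec cs″
                   (trans degs″ (cong (replicate n j ++_) D.degs′)) _ all″)
      U-large M
    where
    module D = Derived c i≤ds cs refl 𝓕 all

  weight-replicate zero    i i≤ds rec = rec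
  weight-replicate (suc n) i i≤ds rec =
    weight-∷ i (All.++⁺ (All.replicate⁺ n ℕ.≤-refl) i≤ds) (weight-replicate n i i≤ds rec)

  recurrence : ∀ d 𝓕 → (∀ {φ} → φ ∈ˡ 𝓕 → Deg≤ (suc d) φ) → Recurrent 𝓕
  recurrence d 𝓕 deg with n , cs , degs , _ , all ← lowerClasses d 𝓕 [] (inj₁ ∘ deg) =
    weight-replicate n d [] weight-[] cs degs 𝓕 all

-- Polynomials with zero constant term

infixl 6 _⊕_

_⊕_ : Polynomial₀ → Polynomial₀ → Polynomial₀
[]       ⊕ Q        = Q
(c ∷ P)  ⊕ []       = c ∷ P
(c ∷ P)  ⊕ (d ∷ Q)  = c + d ∷ P ⊕ Q

eval-⊕ : ∀ P Q x → eval (P ⊕ Q) x ≡ eval P x + eval Q x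
eval-⊕ []      Q       x = sym (ℤ.+-identityˡ _)
eval-⊕ (c ∷ P) []      x = sym (ℤ.+-identityʳ _)
eval-⊕ (c ∷ P) (d ∷ Q) x =
  trans (cong (λ e → x * (c + d + e)) (eval-⊕ P Q x)) (distrib x c d (eval P x) (eval Q x))
  where
  distrib : ∀ x c d p q → x * (c + d + (p + q)) ≡ x * (c + p) + x * (d + q)
  distrib = ℤ-Solver.solve-∀

length-⊕ : ∀ {n} P Q → length P ≤ n → length Q ≤ n → length (P ⊕ Q) ≤ n
length-⊕ []      Q       _         Q≤n       = Q≤n
length-⊕ (c ∷ P) []      P≤n       _         = P≤n
length-⊕ (c ∷ P) (d ∷ Q) (s≤s P≤n) (s≤s Q≤n) = s≤s (length-⊕ P Q P≤n Q≤n)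

scale : ℤ → Polynomial₀ → Polynomial₀
scale x = map (x *_)

eval-scale : ∀ a P x → eval (scale a P) x ≡ a * eval P x
eval-scale a []      x = sym (ℤ.*-zeroʳ a)
eval-scale a (c ∷ P) x =
  trans (cong (λ e → x * (a * c + e)) (eval-scale a P x)) (distrib a x c (eval P x))
  where
  distrib : ∀ a x c p → x * (a * c + a * p) ≡ a * (x * (c + p))
  distrib = ℤ-Solver.solve-∀

-- P(x + y) - P(x) - P(y) as a polynomial in y.
cross : ℤ → Polynomial₀ → Polynomial₀
cross x []               = []
cross x (c ∷ [])         = []
cross x (c ∷ cs@(_ ∷ _)) = scale x cs ⊕ scale x (cross x cs) ⊕ (eval cs x ∷ cross x cs)

eval-cross : ∀ x P y → eval (cross x P) y ≡ eval P (x + y) - eval P x - eval P y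
eval-cross x []       y = refl
eval-cross x (c ∷ []) y = linear x y c
  where
  linear : ∀ x y c → 0ℤ ≡ (x + y) * (c + 0ℤ) - x * (c + 0ℤ) - y * (c + 0ℤ)
  linear = ℤ-Solver.solve-∀
eval-cross x (c ∷ cs@(_ ∷ _)) y = begin
  eval (scale x cs ⊕ scale x R ⊕ (eval cs x ∷ R)) y
    ≡⟨ eval-⊕ (scale x cs ⊕ scale x R) (eval cs x ∷ R) y ⟩
  eval (scale x cs ⊕ scale x R) y + y * (eval cs x + eval R y)
    ≡⟨ cong (_+ y * (eval cs x + eval R y)) (trans (eval-⊕ (scale x cs) (scale x R) y)
         (cong₂ _+_ (eval-scale x cs y) (eval-scale x R y))) ⟩
  x * eval cs y + x * eval R y + y * (eval cs x + eval R y)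
    ≡⟨ cong (λ r → x * eval cs y + x * r + y * (eval cs x + r)) (eval-cross x cs y) ⟩
  x * eval cs y + x * (eval cs (x + y) - eval cs x - eval cs y)
    + y * (eval cs x + (eval cs (x + y) - eval cs x - eval cs y))
    ≡⟨ rearrange x y c (eval cs (x + y)) (eval cs x) (eval cs y) ⟩
  (x + y) * (c + eval cs (x + y)) - x * (c + eval cs x) - y * (c + eval cs y) ∎
  where
  open ≡-Reasoning
  R = cross x cs
  rearrange : ∀ x y c e p q →
    x * q + x * (e - p - q) + y * (p + (e - p - q)) ≡ (x + y) * (c + e) - x * (c + p) - y * (c + q)
  rearrange = ℤ-Solver.solve-∀

length-cross : ∀ x P → length (cross x P) ≤ ℕ.pred (length P)
length-cross x []               = z≤n
length-cross x (c ∷ [])         = z≤n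
length-cross x (c ∷ cs@(_ ∷ _)) =
  length-⊕ (scale x cs ⊕ scale x R) (eval cs x ∷ R)
    (length-⊕ (scale x cs) (scale x R)
      (ℕ.≤-reflexive (List.length-map (x *_) cs))
      (ℕ.≤-trans (ℕ.≤-reflexive (List.length-map (x *_) R)) (ℕ.m≤n⇒m≤1+n (length-cross x cs))))
    (s≤s (length-cross x cs))
  where
  R = cross x cs

translate : ℤ → Polynomial₀ → Polynomial₀
translate x P = cross x P ⊕ P

eval-translate : ∀ x P y → eval (translate x P) y ≡ eval P (x + y) - eval P x
eval-translate x P y = trans (eval-⊕ (cross x P) P y)
  (trans (cong (_+ eval P y) (eval-cross x P y)) (cancel (eval P (x + y)) (eval P x) (eval P y)))
  where
  cancel : ∀ a b c → a - b - c + c ≡ a - b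
  cancel = ℤ-Solver.solve-∀

eval-cong : ∀ P Q → Setoid._≈_ ℙ P Q → ∀ x → eval P x ≡ eval Q x
eval-cong []      []      _   x = refl
eval-cong []      (d ∷ Q) P≈Q x = trans (sym (ℤ.*-zeroʳ x))
  (cong (x *_) (cong₂ _+_ (P≈Q 0) (eval-cong [] Q (P≈Q ∘ suc) x)))
eval-cong (c ∷ P) []      P≈Q x = trans
  (cong (x *_) (cong₂ _+_ (P≈Q 0) (eval-cong P [] (P≈Q ∘ suc) x))) (ℤ.*-zeroʳ x)
eval-cong (c ∷ P) (d ∷ Q) P≈Q x =
  cong (x *_) (cong₂ _+_ (P≈Q 0) (eval-cong P Q (P≈Q ∘ suc) x))

eval-deg : ∀ {s : SetMap} → (∀ u v → s (u ++ v) ≡ s u + s v) →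
           ∀ n P → length P ≤ n → Deg≤ n (eval P ∘ s)
eval-deg s-+ zero    []      _   = zero λ _ → refl
eval-deg {s} s-+ (suc n) P P≤n = suc λ u → Deg≤-cong
  (λ v → trans (eval-cross (s u) P (s v))
    (cong (λ e → eval P e - eval P (s u) - eval P (s v)) (sym (s-+ u v))))
  (eval-deg s-+ n (cross (s u) P) (ℕ.≤-trans (length-cross (s u) P) (ℕ.pred-mono-≤ P≤n)))

-- Sums over finite sets

listSum : (ℕ⁺ → ℕ⁺) → SetMap
listSum f []      = 0ℤ
listSum f (t ∷ β) = toℤ (f t) + listSum f β

listSum-++ : ∀ f u v → listSum f (u ++ v) ≡ listSum f u + listSum f v
listSum-++ f []      v = sym (ℤ.+-identityˡ _)
listSum-++ f (t ∷ u) v = trans (cong (_+_ (toℤ (f t))) (listSum-++ f u v))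
  (sym (ℤ.+-assoc (toℤ (f t)) (listSum f u) (listSum f v)))

listSum-cong : ∀ {f g} → f ≗ g → listSum f ≗ listSum g
listSum-cong f≗g []      = refl
listSum-cong f≗g (t ∷ β) = cong₂ _+_ (cong toℤ (f≗g t)) (listSum-cong f≗g β)

toℤ-∑ : ∀ β f → toℤ (∑ β f) ≡ listSum f (List⁺.toList (elements β))
toℤ-∑ β f = go (List⁺.head (elements β)) (List⁺.tail (elements β))
  where
  go : ∀ t ts → toℤ (foldr₁ _+⁺_ (List⁺.map f (t ∷ ts))) ≡ listSum f (t ∷ ts)
  go t []       = sym (ℤ.+-identityʳ _)
  go t (u ∷ ts) = cong (_+_ (toℤ (f t))) (go u ts)

Increasing⇒All> : ∀ {M β N} → Increasing M β N → All (λ t → M < value t) β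
Increasing⇒All> []          = []
Increasing⇒All> (M<t ∷ inc) = M<t ∷ All.map (ℕ.<-trans M<t) (Increasing⇒All> inc)

Increasing⇒Unique : ∀ {M β N} → Increasing M β N → Unique β
Increasing⇒Unique []          = []
Increasing⇒Unique (M<t ∷ inc) =
  All.map (λ t<s t≡s → ℕ.<⇒≢ t<s (cong value t≡s)) (Increasing⇒All> inc) ∷ Increasing⇒Unique inc

-- Ultrafilters

excludedMiddle : ∀ {X} → Ultrafilter X → (P : Set) → Dec P
excludedMiddle p P with Ultrafilter.ultra p (λ _ → P)
... | inj₁ m = yes (proj₂ (Ultrafilter.inhabited p m))
... | inj₂ m = no (proj₂ (Ultrafilter.inhabited p m))

full : ∀ {X} (p : Ultrafilter X) {A : Pred X 0ℓ} → (∀ x → A x) → A ∈ members p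
full p {A} all with Ultrafilter.ultra p A
... | inj₁ m = m
... | inj₂ m = ⊥-elim (let x , ¬a = Ultrafilter.inhabited p m in ¬a (all x))

value>0 : (x : ℕ⁺) → 0 < value x
value>0 ⟨ n ⟩ = ℕ.>-nonZero⁻¹ n

tail∈ : ∀ p → Idempotent p → ∀ n → (λ x → n < value x) ∈ members p
tail∈ p idem zero    = full p value>0
tail∈ p idem (suc n) = proj₁ idem (full p λ x →
  Ultrafilter.upward p (λ n<y → ℕ.+-mono-≤ (value>0 x) n<y) (tail∈ p idem n))

positive : ∀ (x : ℕ⁺) z → ∣ z ∣ < value x → Σ ℕ⁺ λ w → toℤ w ≡ toℤ x + z
positive x (+ n)      _   = ⟨ value x ℕ.+ n ⟩ {{ℕ.>-nonZero (ℕ.<-≤-trans (value>0 x) (ℕ.m≤m+n _ n))}} , refl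
positive x (-[1+ n ]) n<x =
  ⟨ value x ℕ.∸ suc n ⟩ {{ℕ.>-nonZero (ℕ.m<n⇒0<n∸m n<x)}} , sym (ℤ.⊖-≥ (ℕ.<⇒≤ n<x))

≈ᵤ-sym : ∀ {X} {p q : Ultrafilter X} → p ≈ᵤ q → q ≈ᵤ p
≈ᵤ-sym (p⊆q , q⊆p) = q⊆p , p⊆q

ℕ⁺-≡ : ∀ {x y : ℕ⁺} → value x ≡ value y → x ≡ y
ℕ⁺-≡ refl = refl

+⁺-assoc : ∀ x y z → x +⁺ y +⁺ z ≡ x +⁺ (y +⁺ z)
+⁺-assoc x y z = ℕ⁺-≡ (ℕ.+-assoc (value x) (value y) (value z))

+ᵤ-assoc : ∀ p q r → p +ᵤ q +ᵤ r ≈ᵤ p +ᵤ (q +ᵤ r)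
+ᵤ-assoc p q r =
  (λ {A} → P.upward (λ {x} → Q.upward (λ {y} → R.upward (λ {z} → subst A (+⁺-assoc x y z))))) ,
  (λ {A} → P.upward (λ {x} → Q.upward (λ {y} → R.upward (λ {z} → subst A (sym (+⁺-assoc x y z))))))
  where
  module P = Ultrafilter p
  module Q = Ultrafilter q
  module R = Ultrafilter r

+ᵤ-leftIdeal : βℕ → Pred βℕ (lsuc 0ℓ)
+ᵤ-leftIdeal p r = ∃[ q ] r ≈ᵤ q +ᵤ p

module Minimal (p : βℕ) (idem : Idempotent p) (p∈K : p ∈ Kβℕ) where

  open Ultrafilter p hiding (members)

  private
    em = excludedMiddle p
    L = proj₁ p∈K
    module L = LeftIdeal (proj₁ (proj₁ (proj₂ p∈K)))

  p∈βℕ+r+p : ∀ r → ∃[ q ] p ≈ᵤ q +ᵤ (r +ᵤ p)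
  p∈βℕ+r+p r = proj₂ (proj₁ (proj₂ p∈K)) (+ᵤ-leftIdeal (r +ᵤ p)) leftIdeal
    (λ { {s} (q , s≈) → L.respects (≈ᵤ-sym {p = s} {q +ᵤ (r +ᵤ p)} s≈)
           (L.absorbs q (L.absorbs r (proj₂ (proj₂ p∈K)))) })
    (proj₂ (proj₂ p∈K))
    where
    leftIdeal : LeftIdeal (+ᵤ-leftIdeal (r +ᵤ p))
    leftIdeal = record
      { respects = λ (s⊆t , t⊆s) (q , s⊆ , ⊆s) → q , (s⊆ ∘ t⊆s) , (s⊆t ∘ ⊆s)
      ; nonempty = p +ᵤ (r +ᵤ p) , p , id , id
      ; absorbs  = λ t {s} (q , s⊆ , ⊆s) → t +ᵤ q ,
          (λ {A} m → proj₂ (+ᵤ-assoc t q (r +ᵤ p)) {A} (Ultrafilter.upward t s⊆ m)) ,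
          (λ {A} m → Ultrafilter.upward t ⊆s (proj₁ (+ᵤ-assoc t q (r +ᵤ p)) {A} m))
      }

  private
    Gap : Pred ℕ⁺ 0ℓ → ℕ → ℕ⁺ → Set
    Gap A N y = ¬ (∃[ x ] value x ≤ N × (λ w → A (x +⁺ (y +⁺ w))) ∈ members p)

    -- The limit along p of the starting points of longer and longer gaps is an
    -- r with A ∉ q + r + p for all q.
    ¬allGaps : ∀ {A} → A ∈ members p → ¬ (∀ N → ∃[ y ] Gap A N y)
    ¬allGaps A∈p gap
      with q , p⊆ , _ ← p∈βℕ+r+p (image (proj₁ ∘ gap ∘ value) p)
      with x , m ← Ultrafilter.inhabited q (p⊆ A∈p)
      with n , m′ , x<n ← inhabited (∩-closed m (tail∈ p idem (value x))) =
      proj₂ (gap (value n)) (x , ℕ.<⇒≤ x<n , m′)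

  syndetic : ∀ {A} → A ∈ members p → ∃[ N ] ∀ y → ∃[ x ] value x ≤ N ×
             (λ w → A (x +⁺ (y +⁺ w))) ∈ members p
  syndetic {A} A∈p with em (∃[ N ] ¬ (∃[ y ] Gap A N y))
  ... | yes (N , ¬gap) = N , λ y → decidable-stable (em _) λ ¬x → ¬gap (y , ¬x)
  ... | no ¬syn = ⊥-elim (¬allGaps A∈p λ N → decidable-stable (em _) λ ¬gap → ¬syn (N , ¬gap))

  Large : Pred (Pred ℤ 0ℓ) 0ℓ
  Large W = ∃[ z ] (λ n → W (toℤ n + z)) ∈ members p

  Large-positive : ∀ W → Large W → ∃[ z ] (λ n → W (toℤ n + toℤ z)) ∈ members p
  Large-positive W (z , m)
    with x , m′ , z<x ← inhabited (∩-closed (proj₂ idem m) (tail∈ p idem ∣ z ∣))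
    with w , w≡ ← positive x z z<x =
    w , upward (λ {n} → subst W (trans (rearrange (toℤ x) (toℤ n) z) (cong (_+_ (toℤ n)) (sym w≡)))) m′
    where
    rearrange : ∀ x n z → x + n + z ≡ n + (x + z)
    rearrange = ℤ-Solver.solve-∀

  Large-upward : ∀ {U V : Pred ℤ 0ℓ} → U ⊆ V → Large U → Large V
  Large-upward U⊆V (z , m) = z , upward U⊆V m

  Large-shift : ∀ U y → Large U → Large (λ z → U (z + y))
  Large-shift U y (z , m) = z - y , upward (λ {n} → subst U (rearrange (toℤ n) z y)) m
    where
    rearrange : ∀ n z y → n + z ≡ n + (z - y) + y
    rearrange = ℤ-Solver.solve-∀

  Large-minimal : ∀ U → Large U →
    ∃[ X ] ∀ {W} → Large W → ∃[ x ] x ∈ˡ X × Large (λ z → W z × U (z + x))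
  Large-minimal U U-large
    with z′ , m′ ← Large-positive U U-large
    with N , syn ← syndetic {λ n → U (toℤ n + toℤ z′)} m′ =
    map shift (upTo (suc N)) , λ {W} W-large → cover {W} W-large
    where
    shift : ℕ → ℤ
    shift n = + n + toℤ z′
    rearrange : ∀ x z w z′ → x + (z + w) + z′ ≡ w + z + (x + z′)
    rearrange = ℤ-Solver.solve-∀
    cover : ∀ {W} → Large W → ∃[ x ] x ∈ˡ map shift (upTo (suc N)) × Large (λ z → W z × U (z + x))
    cover {W} W-large with z , m ← Large-positive W W-large with x , x≤N , mU ← syn z =
      shift (value x) , ∈ₚ.∈-map⁺ shift (∈ₚ.∈-upTo⁺ (s≤s x≤N)) , toℤ z ,
      upward (λ {w} (a , b) → a , subst U (rearrange (toℤ x) (toℤ z) (toℤ w) (toℤ z′)) b) (∩-closed m mU)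

  open PET Large Large-upward Large-shift Large-minimal using (recurrence)

  minimal⇒𝒥ₚ : p ∈ 𝒥ₚ
  minimal⇒𝒥ₚ A A∈p F H = finish
    (recurrence (proj₁ bound) 𝓕 𝓕-deg {_∈ℤ A}
      (0ℤ , upward (λ {n} a → n , a , sym (ℤ.+-identityʳ (toℤ n))) A∈p) 0)
    where
    Fs = List⁺.toList (elements F)
    Hs = List⁺.toList (elements H)

    bound : ∃[ d ] ∀ {P} → P ∈ˡ Fs → length P ≤ d
    bound = upperBound length Fs

    setMap : Polynomial₀ → (ℕ⁺ → ℕ⁺) → SetMap
    setMap P f = eval P ∘ listSum f

    𝓕 : List SetMap
    𝓕 = cartesianProductWith setMap Fs Hs

    𝓕-deg : ∀ {φ} → φ ∈ˡ 𝓕 → Deg≤ (suc (proj₁ bound)) φ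
    𝓕-deg φ∈ with P , f , P∈ , f∈ , refl ← ∈ₚ.∈-cartesianProductWith⁻ setMap Fs Hs φ∈ =
      eval-deg (listSum-++ f) _ P (ℕ.m≤n⇒m≤1+n (proj₂ bound P∈))

    finish : (∃₂ λ β N → Increasing 0 β N × β ≢ [] ×
               Large (λ z → (z ∈ℤ A) × ∀ φ → φ ∈ˡ 𝓕 → (z + φ β) ∈ℤ A)) →
             ∃[ a ] Σ (𝒫f ℕ⁺-setoid) λ β → ∀ P f → P ∈ᶠ F → f ∈ᶠ H →
               toℤ a + eval P (toℤ (∑ β f)) ∈ℤ A
    finish ([]     , _ , _   , β≢[] , _) = contradiction refl β≢[]
    finish (t ∷ ts , N , inc , _    , z , m)
      with n , (_ , returns) , z<n ← inhabited (∩-closed m (tail∈ p idem ∣ z ∣))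
      with a , a≡ ← positive n z z<n =
      a , β , λ P f P∈ f∈ →
        let P′ , P′∈ , P≈P′ = find P∈
            f′ , f′∈ , f≗f′ = find f∈
        in subst (_∈ℤ A)
             (cong₂ _+_ (sym a≡)
               (trans (sym (eval-cong P P′ P≈P′ (listSum f′ (t ∷ ts))))
                 (cong (eval P) (trans (sym (listSum-cong f≗f′ (t ∷ ts))) (sym (toℤ-∑ β f))))))
             (returns _ (∈ₚ.∈-cartesianProductWith⁺ setMap P′∈ f′∈))
      where
      β : 𝒫f ℕ⁺-setoid
      β = record { elements = t ∷ ts ; unique = Increasing⇒Unique inc }

-- α and H have to respect equality of finite sets, so their values are chosen by
-- an operator that sees only the extension of the predicate.
record Choice (X : Set) : Set₁ where
  field
    ε      : Pred X 0ℓ → X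
    ε-spec : ∀ Q → ∃ Q → Q (ε Q)
    ε-cong : ∀ Q R → Q ≐ R → ε Q ≡ ε R

open Choice

Choice-retract : ∀ {X Y : Set} (f : X → Y) (g : Y → X) → (∀ y → f (g y) ≡ y) → Choice X → Choice Y
Choice-retract f g fg c = record
  { ε      = λ Q → f (ε c (Q ∘ f))
  ; ε-spec = λ Q (y , q) → ε-spec c (Q ∘ f) (g y , subst Q (sym (fg y)) q)
  ; ε-cong = λ Q R (Q⊆R , R⊆Q) → cong f (ε-cong c (Q ∘ f) (R ∘ f) (Q⊆R , R⊆Q))
  }

Choice-Σ : ∀ {X : Set} {Y : X → Set} → Choice X → (∀ x → Choice (Y x)) → Choice (Σ X Y)
Choice-Σ {X} {Y} cX cY = record
  { ε      = λ Q → ε cX (∃Y Q) , ε (cY _) (λ y → Q (_ , y))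
  ; ε-spec = λ Q ((x , y) , q) →
      ε-spec (cY _) (λ y → Q (_ , y)) (ε-spec cX (∃Y Q) (x , y , q))
  ; ε-cong = λ Q R (Q⊆R , R⊆Q) →
      go Q R (Q⊆R , R⊆Q) (ε-cong cX (∃Y Q) (∃Y R) (map₂ Q⊆R , map₂ R⊆Q))
  }
  where
  ∃Y : Pred (Σ X Y) 0ℓ → Pred X 0ℓ
  ∃Y Q x = ∃[ y ] Q (x , y)
  go : ∀ Q R → Q ≐ R → ∀ {x x′} → x ≡ x′ →
       (x , ε (cY x) (λ y → Q (x , y))) ≡ (x′ , ε (cY x′) (λ y → R (x′ , y)))
  go Q R (Q⊆R , R⊆Q) {x} refl =
    cong (x ,_) (ε-cong (cY x) (λ y → Q (x , y)) (λ y → R (x , y)) (Q⊆R , R⊆Q))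

Choice-Vec : ∀ {X} → Choice X → ∀ n → Choice (Vec X n)
Choice-Vec c zero    = record { ε = λ _ → [] ; ε-spec = λ { Q ([] , q) → q } ; ε-cong = λ _ _ _ → refl }
Choice-Vec c (suc n) = Choice-retract (λ (x , xs) → x ∷ xs) (λ { (x ∷ xs) → x , xs })
  (λ { (x ∷ xs) → refl }) (Choice-Σ c (λ _ → Choice-Vec c n))

module _ {G C : Set} (size : G → ℕ) (_⊏_ : G → G → Set) (⊏⇒< : ∀ {K L} → K ⊏ L → size K < size L)
         (F : (G → C) → G → C)
         (F-local : ∀ {φ ψ L} → (∀ K → K ⊏ L → φ K ≡ ψ K) → F φ L ≡ F ψ L)
         (default : C) where

  private
    approx : ℕ → G → C
    approx zero    _ = default
    approx (suc n)   = F (approx n)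

    agree : ∀ m n L → size L < m → size L < n → approx m L ≡ approx n L
    agree (suc m) (suc n) L L<m L<n = F-local λ K K⊏L →
      agree m n K (ℕ.<-≤-trans (⊏⇒< K⊏L) (ℕ.s≤s⁻¹ L<m)) (ℕ.<-≤-trans (⊏⇒< K⊏L) (ℕ.s≤s⁻¹ L<n))

  recursion : ∃[ φ ] ∀ L → φ L ≡ F φ L
  recursion = (λ L → approx (suc (size L)) L) , λ L → F-local λ K K⊏L →
    agree (size L) (suc (size K)) K (⊏⇒< K⊏L) ℕ.≤-refl

Finite : ∀ {Q : Set} → Pred Q 0ℓ → Set
Finite R = ∃[ l ] ∀ {q} → R q → q ∈ˡ l

Finite-× : ∀ {Q Q′ : Set} {R : Pred Q 0ℓ} {R′ : Pred Q′ 0ℓ} → Finite R → Finite R′ →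
           Finite (λ (q , q′) → R q × R′ q′)
Finite-× (l , ∈l) (l′ , ∈l′) = cartesianProduct l l′ , λ (r , r′) → ∈ₚ.∈-cartesianProduct⁺ (∈l r) (∈l′ r′)

Finite-⋃ : ∀ {Y Q : Set} (ys : List Y) {R : Y → Pred Q 0ℓ} → (∀ y → Finite (R y)) →
           Finite (λ q → ∃[ y ] y ∈ˡ ys × R y q)
Finite-⋃ ys fin = concatMap (proj₁ ∘ fin) ys , λ (y , y∈ , r) →
  Any.concat⁺ (Any.map⁺ (Any.map (λ { refl → proj₂ (fin y) r }) y∈))

∩-finite : ∀ {X Q : Set} (p : Ultrafilter X) {R : Pred Q 0ℓ} {D : Q → Pred X 0ℓ} →
           Finite R → (∀ {q} → R q → D q ∈ members p) →
           (λ x → ∀ {q} → R q → D q x) ∈ members p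
∩-finite {X} {Q} p {R} {D} (l , ∈l) D∈p =
  upward (λ all {q} r → all (∈l r) r) (go l)
  where
  open Ultrafilter p hiding (members)
  go : ∀ qs → (λ x → ∀ {q} → q ∈ˡ qs → R q → D q x) ∈ members p
  go []       = full p (λ x ())
  go (q ∷ qs) = upward (λ { (d , ds) (here refl) r → d r ; (d , ds) (there q∈) r → ds q∈ r })
    (∩-closed here∈ (go qs))
    where
    here∈ : (λ x → R q → D q x) ∈ members p
    here∈ with excludedMiddle p (R q)
    ... | yes r = upward (λ d _ → d) (D∈p r)
    ... | no ¬r = full p (λ _ r → ⊥-elim (¬r r))

module Classical (em : (P : Set) → Dec P) where

  least : ∀ {Q : Pred ℕ 0ℓ} → ∃ Q → ∃[ n ] Q n × (∀ m → Q m → n ≤ m)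
  least {Q} (n , q) = <-rec (λ n → Q n → ∃[ n ] Q n × (∀ m → Q m → n ≤ m)) go n q
    where
    go : ∀ n → (∀ {m} → m < n → Q m → ∃[ n ] Q n × (∀ m → Q m → n ≤ m)) →
         Q n → ∃[ n ] Q n × (∀ m → Q m → n ≤ m)
    go n rec q with em (∃[ m ] m < n × Q m)
    ... | yes (m , m<n , q′) = rec m<n q′
    ... | no none = n , q , λ m q′ → ℕ.≮⇒≥ (λ m<n → none (m , m<n , q′))

  Choice-ℕ : Choice ℕ
  Choice-ℕ = record { ε = pick ; ε-spec = pick-spec ; ε-cong = pick-cong }
    where
    pick : Pred ℕ 0ℓ → ℕ
    pick Q with em (∃ Q)
    ... | yes q = proj₁ (least q)
    ... | no _  = 0
    pick-spec : ∀ Q → ∃ Q → Q (pick Q)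
    pick-spec Q q with em (∃ Q)
    ... | yes q′ = proj₁ (proj₂ (least q′))
    ... | no ¬q  = ⊥-elim (¬q q)
    pick-cong : ∀ Q R → Q ≐ R → pick Q ≡ pick R
    pick-cong Q R (Q⊆R , R⊆Q) with em (∃ Q) | em (∃ R)
    ... | no _   | no _   = refl
    ... | yes q  | no ¬r  = ⊥-elim (¬r (map₂ Q⊆R q))
    ... | no ¬q  | yes r  = ⊥-elim (¬q (map₂ R⊆Q r))
    ... | yes q  | yes r  with n , qn , n≤ ← least q | m , rm , m≤ ← least r =
      ℕ.≤-antisym (n≤ m (R⊆Q rm)) (m≤ n (Q⊆R qn))

  Choice-ℕ⁺ : Choice ℕ⁺
  Choice-ℕ⁺ = Choice-retract (λ n → ⟨ suc n ⟩) (ℕ.pred ∘ value)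
    (λ { ⟨ n ⟩ → ℕ⁺-≡ (ℕ.suc-pred n) }) Choice-ℕ

  Choice-List : ∀ {X} → Choice X → Choice (List X)
  Choice-List c = Choice-retract (Vec.toList ∘ proj₂) (λ xs → length xs , Vec.fromList xs)
    Vec.toList∘fromList (Choice-Σ Choice-ℕ (Choice-Vec c))

  module FiniteSets (S : Setoid 0ℓ 0ℓ) where

    open Setoid S renaming (Carrier to X; refl to ≈-refl; sym to ≈-sym; trans to ≈-trans)
    open Membership S using () renaming (_∈_ to _∈ₗ_)
    open SetoidLists S

    decSetoid : DecSetoid 0ℓ 0ℓ
    decSetoid = record { isDecEquivalence = record { isEquivalence = isEquivalence ; _≟_ = λ x y → em (x ≈ y) } }

    open DecSetoid decSetoid using (_≟_)

    fromList⁺ : List⁺ X → 𝒫f S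
    fromList⁺ (x ∷ xs) = record
      { elements = x ∷ filter (λ y → ¬? (x ≟ y)) (deduplicate _≟_ xs)
      ; unique   = Uniqueness.deduplicate-! decSetoid (x ∷ xs)
      }

    ∈-fromList⁺⁺ : ∀ {y} xs → y ∈ₗ List⁺.toList xs → y ∈ᶠ fromList⁺ xs
    ∈-fromList⁺⁺ (x ∷ xs) = ∈ₛ.∈-deduplicate⁺ S _≟_ (λ y≈z y≈x → ≈-trans y≈x (≈-sym y≈z)) {x ∷ xs}

    ∈-fromList⁺⁻ : ∀ {y} xs → y ∈ᶠ fromList⁺ xs → y ∈ₗ List⁺.toList xs
    ∈-fromList⁺⁻ (x ∷ xs) = ∈ₛ.∈-deduplicate⁻ S _≟_ (x ∷ xs)

    size : 𝒫f S → ℕ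
    size = length ∘ List⁺.toList ∘ elements

    ⊊⇒∉ : ∀ {K G : 𝒫f S} → K ⊊ G → ∃[ y ] y ∈ᶠ G × ¬ (_∈ᶠ_ {S} y K)
    ⊊⇒∉ (K⊆G , K≉G) = decidable-stable (em _) λ none →
      K≉G (K⊆G , λ {y} y∈G → decidable-stable (em _) λ y∉K → none (y , y∈G , y∉K))

    ⊊⇒size< : ∀ {K G : 𝒫f S} → K ⊊ G → size K < size G
    ⊊⇒size< {K} {G} K⊊G with y , y∈G , y∉K ← ⊊⇒∉ {K} {G} K⊊G =
      Unique-⊆⇒length≤ (All.¬Any⇒All¬ _ y∉K ∷ 𝒫f.unique K) λ where
        (here x≈y)  → Any.map (≈-trans x≈y) y∈G
        (there x∈K) → proj₁ K⊊G x∈K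

    ⊊-trans : ∀ {K L G : 𝒫f S} → K ⊊ L → L ⊊ G → K ⊊ G
    ⊊-trans (K⊆L , K≉L) (L⊆G , _) = (λ x∈ → L⊆G (K⊆L x∈)) , λ (_ , G⊆K) →
      K≉L (K⊆L , λ x∈ → G⊆K (L⊆G x∈))

    ⊊-respˡ : ∀ {K K′ G : 𝒫f S} → K ≈ᶠ K′ → K ⊊ G → K′ ⊊ G
    ⊊-respˡ (K⊆K′ , K′⊆K) (K⊆G , K≉G) = (λ x∈ → K⊆G (K′⊆K x∈)) , λ (_ , G⊆K′) →
      K≉G (K⊆G , λ x∈ → K′⊆K (G⊆K′ x∈))

    ⊊-respʳ : ∀ {K G G′ : 𝒫f S} → G ≈ᶠ G′ → K ⊊ G → K ⊊ G′
    ⊊-respʳ (G⊆G′ , G′⊆G) (K⊆G , K≉G) = (λ x∈ → G⊆G′ (K⊆G x∈)) , λ (_ , G′⊆K) →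
      K≉G (K⊆G , λ x∈ → G′⊆K (G⊆G′ x∈))

    ⊊-wellFounded : WF.WellFounded (_⊊_ {S})
    ⊊-wellFounded = WF.Subrelation.wellFounded (λ {K} {G} → ⊊⇒size< {K} {G}) (On.wellFounded size <-wellFounded)

    sublists : List X → List (List X)
    sublists []       = [] ∷ []
    sublists (x ∷ xs) = sublists xs ++ map (x ∷_) (sublists xs)

    filter∈sublists : ∀ {P : Pred X 0ℓ} (P? : ∀ x → Dec (P x)) xs → filter P? xs ∈ˡ sublists xs
    filter∈sublists P? []       = here refl
    filter∈sublists P? (x ∷ xs) with P? x
    ... | yes _ = ∈ₚ.∈-++⁺ʳ (sublists xs) (∈ₚ.∈-map⁺ (x ∷_) (filter∈sublists P? xs))
    ... | no  _ = ∈ₚ.∈-++⁺ˡ (filter∈sublists P? xs)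

    -- The empty sublist has no counterpart in 𝒫f and is sent to G.
    toSubset : 𝒫f S → List X → 𝒫f S
    toSubset G []       = G
    toSubset G (x ∷ xs) = fromList⁺ (x ∷ xs)

    subsets : 𝒫f S → List (𝒫f S)
    subsets G = map (toSubset G) (sublists (List⁺.toList (elements G)))

    subsets-complete : ∀ {K G : 𝒫f S} → K ⊆ᶠ G → ∃[ K′ ] K′ ∈ˡ subsets G × K ≈ᶠ K′
    subsets-complete {K} {G} K⊆G = go ys refl
      where
      xs = List⁺.toList (elements G)
      _∈K? = λ x → em (_∈ᶠ_ {S} x K)
      ys = filter _∈K? xs

      resp : ∀ {x y} → x ≈ y → _∈ᶠ_ {S} x K → _∈ᶠ_ {S} y K
      resp x≈y = Any.map (≈-trans (≈-sym x≈y))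

      K⊆ys : ∀ {x} → _∈ᶠ_ {S} x K → x ∈ₗ ys
      K⊆ys x∈K = ∈ₛ.∈-filter⁺ S _∈K? resp (K⊆G x∈K) x∈K

      ys⊆K : ∀ {x} → x ∈ₗ ys → _∈ᶠ_ {S} x K
      ys⊆K x∈ys = proj₂ (∈ₛ.∈-filter⁻ S _∈K? resp {xs = xs} x∈ys)

      go : ∀ zs → ys ≡ zs → ∃[ K′ ] K′ ∈ˡ subsets G × K ≈ᶠ K′
      go []       eq = case subst (List⁺.head (elements K) ∈ₗ_) eq (K⊆ys (here ≈-refl)) of λ ()
      go (z ∷ zs) eq = fromList⁺ (z ∷ zs) ,
        subst (λ l → toSubset G l ∈ˡ subsets G) eq (∈ₚ.∈-map⁺ (toSubset G) (filter∈sublists _∈K? xs)) ,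
        (λ x∈K → ∈-fromList⁺⁺ (z ∷ zs) (subst (_ ∈ₗ_) eq (K⊆ys x∈K))) ,
        (λ x∈ → ys⊆K (subst (_ ∈ₗ_) (sym eq) (∈-fromList⁺⁻ (z ∷ zs) x∈)))

    Finite-⋃⊊ : ∀ {Q : Set} {R : 𝒫f S → Pred Q 0ℓ} {G} →
                (∀ {K K′} → K ≈ᶠ K′ → R K ⊆ R K′) →
                (∀ {K} → K ⊊ G → Finite (R K)) → Finite (λ q → ∃[ K ] K ⊊ G × R K q)
    Finite-⋃⊊ {Q} {R} {G} R-resp fin = proj₁ union , λ (K , K⊊G , r) →
      let K′ , K′∈ , K≈K′ = subsets-complete {K} {G} (proj₁ K⊊G)
      in proj₂ union (K′ , K′∈ , ⊊-respˡ {K} {K′} {G} K≈K′ K⊊G , R-resp {K} {K′} K≈K′ r)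
      where
      fin′ : ∀ K → Finite (λ q → K ⊊ G × R K q)
      fin′ K with em (K ⊊ G)
      ... | yes K⊊G = proj₁ (fin K⊊G) , λ (_ , r) → proj₂ (fin K⊊G) r
      ... | no ¬K⊊G = [] , λ (K⊊G , _) → ⊥-elim (¬K⊊G K⊊G)
      union = Finite-⋃ (subsets G) {λ K q → K ⊊ G × R K q} fin′

sum⁺ : List⁺ ℕ⁺ → (ℕ⁺ → ℕ⁺) → ℕ⁺
sum⁺ l f = foldr₁ _+⁺_ (List⁺.map f l)

max⁺ min⁺ : List⁺ ℕ⁺ → ℕ
max⁺ l = foldr₁ ℕ._⊔_ (List⁺.map value l)
min⁺ l = foldr₁ ℕ._⊓_ (List⁺.map value l)

sum⁺-cong : ∀ l {f g} → f ≗ g → sum⁺ l f ≡ sum⁺ l g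
sum⁺-cong l {f} {g} f≗g = go (List⁺.head l) (List⁺.tail l)
  where
  go : ∀ t ts → sum⁺ (t ∷ ts) f ≡ sum⁺ (t ∷ ts) g
  go t []       = f≗g t
  go t (u ∷ ts) = cong₂ _+⁺_ (f≗g t) (go u ts)

sum⁺-map : ∀ l g f → sum⁺ (List⁺.map g l) f ≡ sum⁺ l (f ∘ g)
sum⁺-map l g f = go (List⁺.head l) (List⁺.tail l)
  where
  go : ∀ t ts → sum⁺ (List⁺.map g (t ∷ ts)) f ≡ sum⁺ (t ∷ ts) (f ∘ g)
  go t []       = refl
  go t (u ∷ ts) = cong (f (g t) +⁺_) (go u ts)

<min⁺ : ∀ l {M} → (∀ {t} → t ∈ˡ List⁺.toList l → M < value t) → M < min⁺ l
<min⁺ l {M} = go (List⁺.head l) (List⁺.tail l)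
  where
  go : ∀ t ts → (∀ {u} → u ∈ˡ t ∷ ts → M < value u) → M < min⁺ (t ∷ ts)
  go t []       M< = M< (here refl)
  go t (u ∷ ts) M< = ℕ.⊓-glb (M< (here refl)) (go u ts (M< ∘ there))

min⁺≤ : ∀ l {t} → t ∈ˡ List⁺.toList l → min⁺ l ≤ value t
min⁺≤ (t ∷ [])     (here refl) = ℕ.≤-refl
min⁺≤ (t ∷ u ∷ ts) (here refl) = ℕ.m⊓n≤m (value t) _
min⁺≤ (t ∷ u ∷ ts) (there t∈)  = ℕ.≤-trans (ℕ.m⊓n≤n (value t) _) (min⁺≤ (u ∷ ts) t∈)

≤max⁺ : ∀ l {t} → t ∈ˡ List⁺.toList l → value t ≤ max⁺ l
≤max⁺ (t ∷ [])     (here refl) = ℕ.≤-refl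
≤max⁺ (t ∷ u ∷ ts) (here refl) = ℕ.m≤m⊔n (value t) _
≤max⁺ (t ∷ u ∷ ts) (there t∈)  = ℕ.≤-trans (≤max⁺ (u ∷ ts) t∈) (ℕ.m≤n⊔m (value t) _)

toℤ-injective : ∀ {x y} → toℤ x ≡ toℤ y → x ≡ y
toℤ-injective eq = ℕ⁺-≡ (ℤ.+-injective eq)

eval-concat : ∀ P w y s a u v → toℤ w ≡ toℤ s + eval P (toℤ u) →
              toℤ y ≡ toℤ a + eval (translate (toℤ u) P) (toℤ v) →
              toℤ (w +⁺ y) ≡ toℤ (a +⁺ s) + eval P (toℤ (v +⁺ u))
eval-concat P w y s a u v w≡ y≡ = begin
  toℤ w + toℤ y
    ≡⟨ cong₂ _+_ w≡ y≡ ⟩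
  toℤ s + eval P (toℤ u) + (toℤ a + eval (translate (toℤ u) P) (toℤ v))
    ≡⟨ cong (λ e → toℤ s + eval P (toℤ u) + (toℤ a + e)) (eval-translate (toℤ u) P (toℤ v)) ⟩
  toℤ s + eval P (toℤ u) + (toℤ a + (eval P (toℤ u + toℤ v) - eval P (toℤ u)))
    ≡⟨ rearrange (toℤ s) (toℤ a) (eval P (toℤ u)) (eval P (toℤ u + toℤ v)) ⟩
  toℤ a + toℤ s + eval P (toℤ u + toℤ v)
    ≡⟨ cong (λ e → toℤ a + toℤ s + eval P e) (ℤ.+-comm (toℤ u) (toℤ v)) ⟩
  toℤ a + toℤ s + eval P (toℤ v + toℤ u) ∎
  where
  open ≡-Reasoning
  rearrange : ∀ s a b c → s + b + (a + (c - b)) ≡ a + s + c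
  rearrange = ℤ-Solver.solve-∀

infix 10 _⋆[_]

_⋆[_] : Pred ℕ⁺ 0ℓ → βℕ → Pred ℕ⁺ 0ℓ
(A ⋆[ p ]) x = A x × (λ y → A (x +⁺ y)) ∈ members p

⋆∈ : ∀ p → Idempotent p → ∀ {A} → A ∈ members p → A ⋆[ p ] ∈ members p
⋆∈ p idem A∈p = Ultrafilter.∩-closed p A∈p (proj₂ idem A∈p)

⋆-translate : ∀ p → Idempotent p → ∀ A {x} → (A ⋆[ p ]) x → (λ y → (A ⋆[ p ]) (x +⁺ y)) ∈ members p
⋆-translate p idem A {x} (_ , A-x∈p) = ∩-closed A-x∈p
  (upward (λ {y} → upward (λ {z} → subst A (sym (+⁺-assoc x y z)))) (proj₂ idem A-x∈p))
  where open Ultrafilter p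

-- The values (α(G) , H(G)), with H(G) listed.
Code : Set
Code = ℕ⁺ × ℕ⁺ × List ℕ⁺

αᶜ : Code → ℕ⁺
αᶜ = proj₁

Hᶜ : Code → List⁺ ℕ⁺
Hᶜ (_ , t , ts) = t ∷ ts

module OneStep
  (p : βℕ) (idem : Idempotent p) (p∈𝒥ₚ : p ∈ 𝒥ₚ) (T : 𝒫f ℙ)
  {I : Set} (B : I → Pred ℕ⁺ 0ℓ) (X : 𝒫f ℕ^ℕ → Pred I 0ℓ)
  (X-mono : ∀ G K → G ⊆ᶠ K → X G ⊆ X K)
  (X-finite : ∀ G → Finite (X G))
  (B∈p : ∀ G {x} → X G x → B x ∈ members p)
  where

  open Ultrafilter p hiding (members)
  private em = excludedMiddle p
  open Classical em
  open FiniteSets ℕ^ℕ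
  private module ℙ-Sets = FiniteSets ℙ

  Ts : List Polynomial₀
  Ts = List⁺.toList (elements T)

  -- Chain φ G x s u: for some G₁ ⊊ … ⊊ Gₙ = G with x ∈ X(G₁) and fᵢ ∈ Gᵢ,
  -- s = ∑ᵢ α(Gᵢ) and u = ∑ᵢ ∑_{t ∈ H(Gᵢ)} fᵢ(t), where φ = (α , H).
  data Chain (φ : 𝒫f ℕ^ℕ → Code) : 𝒫f ℕ^ℕ → I → ℕ⁺ → ℕ⁺ → Set where
    start  : ∀ {G x f} → X G x → f ∈ᶠ G → Chain φ G x (αᶜ (φ G)) (sum⁺ (Hᶜ (φ G)) f)
    extend : ∀ {K G x s u f} → Chain φ K x s u → K ⊊ G → f ∈ᶠ G →
             Chain φ G x (αᶜ (φ G) +⁺ s) (sum⁺ (Hᶜ (φ G)) f +⁺ u)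

  record Good (φ : 𝒫f ℕ^ℕ → Code) (G : 𝒫f ℕ^ℕ) (c : Code) : Set where
    field
      unique    : Unique (List⁺.toList (Hᶜ c))
      separated : ∀ {K} → K ⊊ G → max⁺ (Hᶜ (φ K)) < min⁺ (Hᶜ c)
      started   : ∀ {x f P} → X G x → f ∈ᶠ G → P ∈ˡ Ts →
                  toℤ (αᶜ c) + eval P (toℤ (sum⁺ (Hᶜ c) f)) ∈ℤ B x ⋆[ p ]
      extended  : ∀ {K x s u f P} → K ⊊ G → Chain φ K x s u → f ∈ᶠ G → P ∈ˡ Ts →
                  toℤ (αᶜ c +⁺ s) + eval P (toℤ (sum⁺ (Hᶜ c) f +⁺ u)) ∈ℤ B x ⋆[ p ]

  open Good

  Chain-local : ∀ {φ ψ G x s u} → φ G ≡ ψ G → (∀ K → K ⊊ G → φ K ≡ ψ K) →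
                Chain φ G x s u → Chain ψ G x s u
  Chain-local {φ} {ψ} {G} {x} eq below (start {f = f} x∈ f∈) =
    subst (λ c → Chain ψ G x (αᶜ c) (sum⁺ (Hᶜ c) f)) (sym eq) (start x∈ f∈)
  Chain-local {φ} {ψ} {G} {x} eq below (extend {K} {s = s} {u} {f} ch K⊊G f∈) =
    subst (λ c → Chain ψ G x (αᶜ c +⁺ s) (sum⁺ (Hᶜ c) f +⁺ u)) (sym eq)
      (extend (Chain-local (below K K⊊G) (λ L L⊊K → below L (⊊-trans {L} {K} {G} L⊊K K⊊G)) ch) K⊊G f∈)

  Good-local : ∀ {φ ψ G c} → (∀ K → K ⊊ G → φ K ≡ ψ K) → Good φ G c → Good ψ G c
  Good-local {G = G} eq good = record
    { unique    = unique good
    ; separated = λ {K} K⊊G → subst (λ d → max⁺ (Hᶜ d) < _) (eq K K⊊G) (separated good {K} K⊊G)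
    ; started   = started good
    ; extended  = λ {K} K⊊G ch → extended good {K} K⊊G
        (Chain-local (sym (eq K K⊊G)) (λ L L⊊K → sym (eq L (⊊-trans {L} {K} {G} L⊊K K⊊G))) ch)
    }

  Good-resp : ∀ {φ G G′ c} → G ≈ᶠ G′ → Good φ G c → Good φ G′ c
  Good-resp {G = G} {G′} (G⊆G′ , G′⊆G) good = record
    { unique    = unique good
    ; separated = λ {K} K⊊G′ → separated good {K} (⊊G {K} K⊊G′)
    ; started   = λ x∈ f∈ → started good (X-mono G′ G G′⊆G x∈) (G′⊆G f∈)
    ; extended  = λ {K} K⊊G′ ch f∈ → extended good {K} (⊊G {K} K⊊G′) ch (G′⊆G f∈)
    }
    where
    ⊊G : ∀ {K : 𝒫f ℕ^ℕ} → K ⊊ G′ → K ⊊ G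
    ⊊G {K} = ⊊-respʳ {K} {G′} {G} (G′⊆G , G⊆G′)

  abstract
    choice : Choice Code
    choice = Choice-Σ Choice-ℕ⁺ (λ _ → Choice-Σ Choice-ℕ⁺ (λ _ → Choice-List Choice-ℕ⁺))

  private
    pick : (𝒫f ℕ^ℕ → Code) → 𝒫f ℕ^ℕ → Code
    pick φ G = Choice.ε choice (Good φ G)

    abstract
      fixed : ∃[ φ ] ∀ G → φ G ≡ pick φ G
      fixed = recursion size _⊊_ (λ {K} {G} → ⊊⇒size< {K} {G}) pick
        (λ {φ} {ψ} {G} eq → Choice.ε-cong choice (Good φ G) (Good ψ G)
          (Good-local eq , Good-local (λ K K⊊G → sym (eq K K⊊G))))
        (1⁺ , 1⁺ , [])

  φ : 𝒫f ℕ^ℕ → Code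
  φ = proj₁ fixed

  φ-cong : ∀ {G G′} → G ≈ᶠ G′ → φ G ≡ φ G′
  φ-cong {G} {G′} (G⊆G′ , G′⊆G) = trans (proj₂ fixed G) (trans
    (Choice.ε-cong choice (Good φ G) (Good φ G′)
      (Good-resp {G = G} {G′} (G⊆G′ , G′⊆G) , Good-resp {G = G′} {G} (G′⊆G , G⊆G′)))
    (sym (proj₂ fixed G′)))

  State : Set
  State = I × ℕ⁺ × ℕ⁺

  ChainAt ChainBelow : 𝒫f ℕ^ℕ → Pred State 0ℓ
  ChainAt G (x , s , u) = Chain φ G x s u
  ChainBelow G q = ∃[ K ] K ⊊ G × ChainAt K q

  ChainAt-resp : ∀ {K K′} → K ≈ᶠ K′ → ChainAt K ⊆ ChainAt K′
  ChainAt-resp {K} {K′} (K⊆K′ , K′⊆K) {x , _} (start {f = f} x∈ f∈) =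
    subst (λ c → Chain φ K′ x (αᶜ c) (sum⁺ (Hᶜ c) f)) (sym (φ-cong {K} {K′} (K⊆K′ , K′⊆K)))
      (start (X-mono K K′ K⊆K′ x∈) (K⊆K′ f∈))
  ChainAt-resp {K} {K′} (K⊆K′ , K′⊆K) {x , _} (extend {L} {s = s} {u} {f} ch L⊊K f∈) =
    subst (λ c → Chain φ K′ x (αᶜ c +⁺ s) (sum⁺ (Hᶜ c) f +⁺ u)) (sym (φ-cong {K} {K′} (K⊆K′ , K′⊆K)))
      (extend ch (⊊-respʳ {L} {K} {K′} (K⊆K′ , K′⊆K) L⊊K) (K⊆K′ f∈))

  below-finite : ∀ {G} → (∀ {K} → K ⊊ G → Finite (ChainAt K)) → Finite (ChainBelow G)
  below-finite {G} = Finite-⋃⊊ {R = ChainAt} {G} (λ {K} {K′} → ChainAt-resp {K} {K′})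

  ChainAt-finite : ∀ G → Finite (ChainAt G)
  ChainAt-finite = WF.All.wfRec ⊊-wellFounded 0ℓ (λ G → Finite (ChainAt G)) step
    where
    step : ∀ G → (∀ {K} → K ⊊ G → Finite (ChainAt K)) → Finite (ChainAt G)
    step G rec = cartesianProductWith first xs fs ++ cartesianProductWith next qs fs , ∈list
      where
      fs = List⁺.toList (elements G)
      a  = αᶜ (φ G)
      h  = Hᶜ (φ G)
      xs = proj₁ (X-finite G)
      below = below-finite {G} (λ {K} K⊊G → rec {K} K⊊G)
      qs = proj₁ below

      first : I → (ℕ⁺ → ℕ⁺) → State
      first x f = x , a , sum⁺ h f

      next : State → (ℕ⁺ → ℕ⁺) → State
      next (x , s , u) f = x , a +⁺ s , sum⁺ h f +⁺ u

      ∈list : ∀ {q} → ChainAt G q → q ∈ˡ cartesianProductWith first xs fs ++ cartesianProductWith next qs fs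
      ∈list {x , _} (start x∈ f∈) =
        let f′ , f′∈ , f≗f′ = find f∈
        in ∈ₚ.∈-++⁺ˡ (subst (λ u → (x , a , u) ∈ˡ cartesianProductWith first xs fs)
             (sym (sum⁺-cong h f≗f′))
             (∈ₚ.∈-cartesianProductWith⁺ first (proj₂ (X-finite G) x∈) f′∈))
      ∈list {x , _} (extend {K} {s = s} {u} ch K⊊G f∈) =
        let f′ , f′∈ , f≗f′ = find f∈
        in ∈ₚ.∈-++⁺ʳ (cartesianProductWith first xs fs)
             (subst (λ v → (x , a +⁺ s , v +⁺ u) ∈ˡ cartesianProductWith next qs fs)
               (sym (sum⁺-cong h f≗f′))
               (∈ₚ.∈-cartesianProductWith⁺ next (proj₂ below (K , K⊊G , ch)) f′∈))

  ChainBelow-finite : ∀ G → Finite (ChainBelow G)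
  ChainBelow-finite G = below-finite {G} (λ {K} _ → ChainAt-finite K)

  chain-sound : ∀ {K x s u P} → Good φ K (φ K) → Chain φ K x s u → P ∈ˡ Ts →
                toℤ s + eval P (toℤ u) ∈ℤ B x ⋆[ p ]
  chain-sound good (start x∈ f∈)            P∈ = started good x∈ f∈ P∈
  chain-sound good (extend {K} ch K⊊G f∈) P∈ = extended good {K} K⊊G ch f∈ P∈

  module Exists (G : 𝒫f ℕ^ℕ) (good : ∀ {K} → K ⊊ G → Good φ K (φ K)) where

    Pair : Set
    Pair = State × Polynomial₀

    Earlier : Pred Pair 0ℓ
    Earlier (q , P) = ChainBelow G q × P ∈ˡ Ts

    Earlier-finite : Finite Earlier
    Earlier-finite = Finite-× (ChainBelow-finite G) (Ts , id)

    Return : Pair → Pred ℕ⁺ 0ℓ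
    Return ((x , s , u) , P) y = ∀ w → toℤ w ≡ toℤ s + eval P (toℤ u) → (B x ⋆[ p ]) (w +⁺ y)

    Return∈p : ∀ {e} → Earlier e → Return e ∈ members p
    Return∈p {(x , s , u) , P} ((K , K⊊G , ch) , P∈)
      with w , w∈ , w≡ ← chain-sound (good {K} K⊊G) ch P∈ =
      upward (λ {y} m w′ w′≡ → subst (λ v → (B x ⋆[ p ]) (v +⁺ y)) (toℤ-injective {w} {w′} (trans w≡ (sym w′≡))) m)
        (⋆-translate p idem (B x) w∈)

    Target : Pred ℕ⁺ 0ℓ
    Target y = (∀ {x} → X G x → (B x ⋆[ p ]) y) × (∀ {e} → Earlier e → Return e y)

    Target∈p : Target ∈ members p
    Target∈p = ∩-closed
      (∩-finite p {D = λ x → B x ⋆[ p ]} (X-finite G) (λ x∈ → ⋆∈ p idem (B∈p G x∈)))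
      (∩-finite p {D = Return} Earlier-finite Return∈p)

    previousMax : ∃[ M ] ∀ {K} → K ⊊ G → max⁺ (Hᶜ (φ K)) ≤ M
    previousMax with M , bound ← upperBound (λ K → max⁺ (Hᶜ (φ K))) (subsets G) = M , λ {K} K⊊G →
      let K′ , K′∈ , K≈K′ = subsets-complete {K} {G} (proj₁ K⊊G)
      in subst (λ c → max⁺ (Hᶜ c) ≤ M) (sym (φ-cong {K} {K′} K≈K′)) (bound K′∈)

    M = proj₁ previousMax

    beyond : ℕ⁺ → ℕ⁺
    beyond t = ⟨ value t ℕ.+ M ⟩ {{ℕ.>-nonZero (ℕ.<-≤-trans (value>0 t) (ℕ.m≤m+n _ M))}}

    beyond-injective : ∀ {t t′} → beyond t ≡ beyond t′ → t ≡ t′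
    beyond-injective {t} {t′} eq = ℕ⁺-≡ (ℕ.+-cancelʳ-≡ M (value t) (value t′) (cong value eq))

    shiftedPolynomial : Pair → Polynomial₀
    shiftedPolynomial ((x , s , u) , P) = translate (toℤ u) P

    polynomials : 𝒫f ℙ
    polynomials = ℙ-Sets.fromList⁺
      (List⁺.head (elements T) ∷ (List⁺.tail (elements T) ++ map shiftedPolynomial (proj₁ Earlier-finite)))

    functions : 𝒫f ℕ^ℕ
    functions = fromList⁺ (List⁺.map (_∘ beyond) (elements G))

    T⊆polynomials : ∀ {P} → P ∈ˡ Ts → P ∈ᶠ polynomials
    T⊆polynomials {P} P∈ = ℙ-Sets.∈-fromList⁺⁺ {P} _
      (Any.map (Setoid.reflexive ℙ) (∈ₚ.∈-++⁺ˡ P∈))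

    shifted∈polynomials : ∀ {e} → Earlier e → shiftedPolynomial e ∈ᶠ polynomials
    shifted∈polynomials {e} earlier = ℙ-Sets.∈-fromList⁺⁺ {shiftedPolynomial e} _
      (Any.map (Setoid.reflexive ℙ) (∈ₚ.∈-++⁺ʳ Ts (∈ₚ.∈-map⁺ shiftedPolynomial (proj₂ Earlier-finite earlier))))

    beyond∈functions : ∀ {f} → f ∈ᶠ G → (f ∘ beyond) ∈ᶠ functions
    beyond∈functions f∈ = ∈-fromList⁺⁺ _ (Any.map⁺ (Any.map (λ f≗g t → f≗g (beyond t)) f∈))

    found : ∀ a (β : 𝒫f ℕ⁺-setoid) →
            (∀ P f → P ∈ᶠ polynomials → f ∈ᶠ functions → toℤ a + eval P (toℤ (∑ β f)) ∈ℤ Target) →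
            ∃ (Good φ G)
    found a β returns =
      (a , List⁺.head (List⁺.map beyond l) , List⁺.tail (List⁺.map beyond l)) , record
        { unique    = Uniqueness.map⁺ ℕ⁺-setoid ℕ⁺-setoid beyond-injective (𝒫f.unique β)
        ; separated = λ {K} K⊊G → ℕ.≤-<-trans (proj₂ previousMax {K} K⊊G) (<min⁺ (List⁺.map beyond l) M<)
        ; started   = λ {x} {f} {P} x∈ f∈ P∈ →
            let y , y∈ , y≡ = returns P (f ∘ beyond) (T⊆polynomials P∈) (beyond∈functions f∈)
            in y , proj₁ y∈ x∈ , trans y≡ (cong (λ v → toℤ a + eval P (toℤ v)) (sym (sum⁺-map l beyond f)))
        ; extended  = extended′
        }
      where
      l = elements β

      M< : ∀ {t} → t ∈ˡ List⁺.toList (List⁺.map beyond l) → M < value t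
      M< t∈ with t′ , _ , refl ← ∈ₚ.∈-map⁻ beyond {xs = List⁺.toList l} t∈ = ℕ.+-monoˡ-≤ M (value>0 t′)

      extended′ : ∀ {K x s u f P} → K ⊊ G → Chain φ K x s u → f ∈ᶠ G → P ∈ˡ Ts →
                  toℤ (a +⁺ s) + eval P (toℤ (sum⁺ (List⁺.map beyond l) f +⁺ u)) ∈ℤ B x ⋆[ p ]
      extended′ {K} {x} {s} {u} {f} {P} K⊊G ch f∈ P∈ =
        let y , y∈ , y≡ = returns (translate (toℤ u) P) (f ∘ beyond)
              (shifted∈polynomials ((K , K⊊G , ch) , P∈)) (beyond∈functions f∈)
            w , w∈ , w≡ = chain-sound (good {K} K⊊G) ch P∈
        in w +⁺ y , proj₂ y∈ ((K , K⊊G , ch) , P∈) w w≡ ,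
           trans (eval-concat P w y s a u (sum⁺ l (f ∘ beyond)) w≡ y≡)
             (cong (λ v → toℤ (a +⁺ s) + eval P (toℤ (v +⁺ u))) (sym (sum⁺-map l beyond f)))

    exists : ∃ (Good φ G)
    exists = let a , β , returns = p∈𝒥ₚ Target Target∈p polynomials functions in found a β returns

  abstract
    φ-good : ∀ G → Good φ G (φ G)
    φ-good = WF.All.wfRec ⊊-wellFounded 0ℓ (λ G → Good φ G (φ G)) λ G rec →
      subst (Good φ G) (sym (proj₂ fixed G))
        (Choice.ε-spec choice (Good φ G) (Exists.exists G (λ {K} K⊊G → rec {K} K⊊G)))

value-sum⁺ : ∀ l g → value (sum⁺ l g) ≡ sum (map (value ∘ g) (List⁺.toList l))
value-sum⁺ l g = go (List⁺.head l) (List⁺.tail l)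
  where
  go : ∀ t ts → value (sum⁺ (t ∷ ts) g) ≡ sum (map (value ∘ g) (t ∷ ts))
  go t []       = sym (ℕ.+-identityʳ _)
  go t (u ∷ ts) = cong (value (g t) ℕ.+_) (go u ts)

sum⁺-↭ : ∀ l l′ → List⁺.toList l ↭ List⁺.toList l′ → ∀ g → sum⁺ l g ≡ sum⁺ l′ g
sum⁺-↭ l l′ l↭l′ g = ℕ⁺-≡ (trans (value-sum⁺ l g)
  (trans (sum-↭ (↭.map⁺ (value ∘ g) l↭l′)) (sym (value-sum⁺ l′ g))))

infix 4 _>⁺_
_>⁺_ : ℕ⁺ → ℕ⁺ → Set
x >⁺ y = value y < value x

descending : ∀ l → Unique (List⁺.toList l) →
             ∃[ l′ ] List⁺.toList l′ ↭ List⁺.toList l × Linked _>⁺_ (List⁺.toList l′)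
descending l l! = go (sort xs) (sort-↭ xs) (sort-↗ xs)
  where
  xs = List⁺.toList l
  open Sort (Flip.decTotalOrder (On.decTotalOrder ℕ.≤-decTotalOrder value)) using (sort; sort-↭; sort-↗)

  strict : ∀ {ys} → Unique ys → Linked (λ x y → value y ≤ value x) ys → Linked _>⁺_ ys
  strict _                    []           = []
  strict _                    [-]          = [-]
  strict ((x≢y ∷ _) ∷ ys!) (y≤x ∷ sorted) =
    ℕ.≤∧≢⇒< y≤x (λ eq → x≢y (ℕ⁺-≡ (sym eq))) ∷ strict ys! sorted

  go : ∀ ys → ys ↭ xs → Linked (λ x y → value y ≤ value x) ys →
       ∃[ l′ ] List⁺.toList l′ ↭ xs × Linked _>⁺_ (List⁺.toList l′)
  go []       []↭ _ = contradiction (↭-sym []↭) ↭.¬x∷xs↭[]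
  go (y ∷ ys) ys↭xs sorted = y ∷ ys , ys↭xs ,
    strict (↭ₛ.Unique-resp-↭ (setoid ℕ⁺) (↭⇒↭ₛ (↭-sym ys↭xs)) l!) sorted

last⁺ : ℕ⁺ → List ℕ⁺ → ℕ⁺
last⁺ h []      = h
last⁺ h (t ∷ l) = last⁺ t l

last⁺∈ : ∀ h l → last⁺ h l ∈ˡ h ∷ l
last⁺∈ h []      = here refl
last⁺∈ h (t ∷ l) = there (last⁺∈ t l)

snoc : ∀ {A : Set} {k} → (Fin k → A) → A → Fin (suc k) → A
snoc {k = zero}  f x _       = x
snoc {k = suc k} f x zero    = f zero
snoc {k = suc k} f x (suc i) = snoc (f ∘ suc) x i

snoc-inject₁ : ∀ {A : Set} {k} (f : Fin k → A) x i → snoc f x (inject₁ i) ≡ f i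
snoc-inject₁ f x zero    = refl
snoc-inject₁ f x (suc i) = snoc-inject₁ (f ∘ suc) x i

snoc-fromℕ : ∀ {A : Set} {k} (f : Fin k → A) x → snoc f x (fromℕ k) ≡ x
snoc-fromℕ {k = zero}  f x = refl
snoc-fromℕ {k = suc k} f x = snoc-fromℕ (f ∘ suc) x

snoc-all : ∀ {A : Set} {k} {f : Fin k → A} {x} (Q : Pred A 0ℓ) → (∀ i → Q (f i)) → Q x → ∀ i → Q (snoc f x i)
snoc-all {k = zero}  Q qf qx zero    = qx
snoc-all {k = suc k} Q qf qx zero    = qf zero
snoc-all {k = suc k} Q qf qx (suc i) = snoc-all Q (qf ∘ suc) qx i

tabulate-∷ʳ : ∀ {A : Set} {k} (g : Fin (suc k) → A) → tabulate g ≡ tabulate (g ∘ inject₁) ∷ʳ g (fromℕ k)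
tabulate-∷ʳ {k = zero}  g = refl
tabulate-∷ʳ {k = suc k} g = cong (g zero ∷_) (tabulate-∷ʳ (g ∘ suc))

-- The functions (αᵢ , Hᵢ) for one index i.
Selector : Set
Selector = (𝒫f-setoid ℕ^ℕ ⟶ₛ ℕ⁺-setoid) × (𝒫f-setoid ℕ^ℕ ⟶ₛ 𝒫f-setoid ℕ⁺-setoid)

blockValue : (ℕ⁺ → 𝒫f ℕ^ℕ) → (ℕ⁺ → ℕ⁺ → ℕ⁺) → Selector → 𝒫f ℕ⁺-setoid → Polynomial₀ → ℤ
blockValue G f (α , H) β P =
  toℤ (∑[ i ∈ β ] (α ⟨$⟩ G i)) + eval P (toℤ (∑[ i ∈ β ] ∑[ t ∈ H ⟨$⟩ G i ] f i t))

-- The tuples in Available G are those produced by blocks of sets strictly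
-- contained in G; only finitely many tuples have to be continued at G.
record Solution (k : ℕ) (A : Pred (Vec ℕ⁺ k) 0ℓ) (T : 𝒫f ℙ) : Set₁ where
  field
    selector         : Fin k → Selector
    separated        : ∀ {G K} → G ⊊ K → ∀ i → (proj₂ (selector i) ⟨$⟩ G) <ᶠ (proj₂ (selector i) ⟨$⟩ K)
    Available        : 𝒫f ℕ^ℕ → Pred (Vec ℕ⁺ k) 0ℓ
    available-mono   : ∀ G K → G ⊆ᶠ K → Available G ⊆ Available K
    available-finite : ∀ G → Finite (Available G)
    available⊆A      : ∀ {G} → Available G ⊆ A
    available        : ∀ (G : ℕ⁺ → 𝒫f ℕ^ℕ) → (∀ i j → value i < value j → G i ⊊ G j) →
      ∀ f → (∀ i → f i ∈ᶠ G i) →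
      ∀ (β : Fin k → 𝒫f ℕ⁺-setoid) → (∀ i j → toℕ j ≡ ℕ.suc (toℕ i) → β i <ᶠ β j) →
      ∀ (P : Fin k → Polynomial₀) → (∀ j → P j ∈ᶠ T) →
      ∀ n → (∀ i → ℕ.suc (toℕ i) ≡ k → max (β i) < value n) →
      ∃[ xs ] Available (G n) xs × Vec.map toℤ xs ≡ tabulate (λ j → blockValue G f (selector j) (β j) (P j))

open Solution

emptySolution : ∀ {T} → Solution 0 (λ _ → ⊤) T
emptySolution = record
  { selector         = λ ()
  ; separated        = λ _ ()
  ; Available        = λ _ _ → ⊤
  ; available-mono   = λ _ _ _ _ → tt
  ; available-finite = λ _ → [] ∷ [] , λ { {[]} _ → here refl }
  ; available⊆A      = λ _ → tt
  ; available        = λ _ _ _ _ _ _ _ _ _ _ → [] , tt , refl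
  }

module Extension
  {k A′ T} (S : Solution k A′ T) (p : βℕ) (idem : Idempotent p) (p∈𝒥ₚ : p ∈ 𝒥ₚ)
  (A : Pred (Vec ℕ⁺ (suc k)) 0ℓ) (A′⇒A : ∀ {xs} → A′ xs → (λ y → A (xs ∷ʳ y)) ∈ members p)
  where

  private
    Fibre : Vec ℕ⁺ k → Pred ℕ⁺ 0ℓ
    Fibre xs y = A (xs ∷ʳ y)

    Fibre∈p : ∀ G {xs} → Available S G xs → Fibre xs ∈ members p
    Fibre∈p G xs∈ = A′⇒A (available⊆A S {G} xs∈)

  open OneStep p idem p∈𝒥ₚ T Fibre (Available S) (available-mono S) (available-finite S) Fibre∈p
  open Classical (excludedMiddle p) using (module FiniteSets)
  open FiniteSets ℕ^ℕ using (⊊-trans)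

  newSelector : Selector
  newSelector =
    record { to = αᶜ ∘ φ ; cong = λ {G} {K} G≈K → cong αᶜ (φ-cong {G} {K} G≈K) } ,
    record
      { to   = λ G → record { elements = Hᶜ (φ G) ; unique = Good.unique (φ-good G) }
      ; cong = λ {G} {K} G≈K → reflexive (cong Hᶜ (φ-cong {G} {K} G≈K))
      }
    where
    reflexive : ∀ {l l′ : List⁺ ℕ⁺} → l ≡ l′ →
      (∀ {x} → x ∈ˡ List⁺.toList l → x ∈ˡ List⁺.toList l′) × (∀ {x} → x ∈ˡ List⁺.toList l′ → x ∈ˡ List⁺.toList l)
    reflexive refl = id , id

  Extended : State × Polynomial₀ → Pred (Vec ℕ⁺ (suc k)) 0ℓ
  Extended ((xs , s , u) , P) zs = ∃[ y ] toℤ y ≡ toℤ s + eval P (toℤ u) × zs ≡ xs ∷ʳ y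

  Available′ : 𝒫f ℕ^ℕ → Pred (Vec ℕ⁺ (suc k)) 0ℓ
  Available′ G zs = ∃[ e ] (ChainBelow G (proj₁ e) × proj₂ e ∈ˡ Ts) × Extended e zs

  Extended-finite : ∀ e → Finite (Extended e)
  Extended-finite ((xs , s , u) , P) = go (excludedMiddle p (∃[ y ] toℤ y ≡ toℤ s + eval P (toℤ u)))
    where
    go : Dec (∃[ y ] toℤ y ≡ toℤ s + eval P (toℤ u)) → Finite (Extended ((xs , s , u) , P))
    go (yes (y , y≡)) = (xs ∷ʳ y) ∷ [] , λ { (y′ , y′≡ , refl) →
      here (cong (xs ∷ʳ_) (toℤ-injective {y′} {y} (trans y′≡ (sym y≡)))) }
    go (no  ¬y)       = [] , λ (y , y≡ , _) → ⊥-elim (¬y (y , y≡))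

  Available′-finite : ∀ G → Finite (Available′ G)
  Available′-finite G =
    let es , ∈es = Finite-× (ChainBelow-finite G) (Ts , id)
        zs , ∈zs = Finite-⋃ es {Extended} Extended-finite
    in zs , λ (e , e∈ , ext) → ∈zs (e , ∈es e∈ , ext)

  Available′⊆A : ∀ {G} → Available′ G ⊆ A
  Available′⊆A (((xs , s , u) , P) , ((K , _ , ch) , P∈) , y , y≡ , refl) =
    let w , (w∈ , _) , w≡ = chain-sound (φ-good K) ch P∈
    in subst (Fibre xs) (toℤ-injective {w} {y} (trans w≡ (sym y≡))) w∈

  module _ (G : ℕ⁺ → 𝒫f ℕ^ℕ) (G-increasing : ∀ i j → value i < value j → G i ⊊ G j)
           (f : ℕ⁺ → ℕ⁺ → ℕ⁺) (f∈ : ∀ i → f i ∈ᶠ G i) where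

    blockChain : ∀ {xs} h t → Linked _>⁺_ (h ∷ t) → Available S (G (last⁺ h t)) xs →
      Chain φ (G h) xs (sum⁺ (h ∷ t) (αᶜ ∘ φ ∘ G)) (sum⁺ (h ∷ t) (λ i → sum⁺ (Hᶜ (φ (G i))) (f i)))
    blockChain h []       _              xs∈ = start xs∈ (f∈ h)
    blockChain h (h′ ∷ t) (h>h′ ∷ desc) xs∈ =
      extend (blockChain h′ t desc xs∈) (G-increasing h′ h h>h′) (f∈ h)

    newSelector-available : ∀ (β : 𝒫f ℕ⁺-setoid) P → P ∈ᶠ T → ∀ n → max β < value n →
      ∃[ b ] b ∈ˡ List⁺.toList (elements β) × ∀ {xs} → Available S (G b) xs →
        ∃[ y ] Available′ (G n) (xs ∷ʳ y) × toℤ y ≡ blockValue G f newSelector β P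
    newSelector-available β P P∈ n β<n
      with (h ∷ t) , l↭β , desc ← descending (elements β) (𝒫f.unique β) =
      last⁺ h t , ↭.∈-resp-↭ l↭β (last⁺∈ h t) , λ {xs} xs∈ →
        let P′ , P′∈ , P≈P′ = find P∈
            ch = blockChain h t desc xs∈
            y , _ , y≡ = chain-sound (φ-good (G h)) ch P′∈
            h<n = ℕ.≤-<-trans (≤max⁺ (elements β) (↭.∈-resp-↭ l↭β (here refl))) β<n
        in y , (_ , ((G h , G-increasing h n h<n , ch) , P′∈) , y , y≡ , refl) ,
           trans y≡ (cong₂ _+_ (cong toℤ (sum⁺-↭ (h ∷ t) (elements β) l↭β _))
             (trans (cong (λ u → eval P′ (toℤ u)) (sum⁺-↭ (h ∷ t) (elements β) l↭β _))
               (sym (eval-cong P P′ P≈P′ _))))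

  selector′ : Fin (suc k) → Selector
  selector′ = snoc (selector S) newSelector

  available′ : ∀ (G : ℕ⁺ → 𝒫f ℕ^ℕ) → (∀ i j → value i < value j → G i ⊊ G j) →
    ∀ f → (∀ i → f i ∈ᶠ G i) →
    ∀ (β : Fin (suc k) → 𝒫f ℕ⁺-setoid) → (∀ i j → toℕ j ≡ ℕ.suc (toℕ i) → β i <ᶠ β j) →
    ∀ (P : Fin (suc k) → Polynomial₀) → (∀ j → P j ∈ᶠ T) →
    ∀ n → (∀ i → ℕ.suc (toℕ i) ≡ ℕ.suc k → max (β i) < value n) →
    ∃[ zs ] Available′ (G n) zs × Vec.map toℤ zs ≡ tabulate (λ j → blockValue G f (selector′ j) (β j) (P j))
  available′ G G-increasing f f∈ β β< P P∈ n β<n =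
    let b , b∈ , continue = newSelector-available G G-increasing f f∈ (β (fromℕ k)) (P (fromℕ k)) (P∈ (fromℕ k)) n
          (β<n (fromℕ k) (cong ℕ.suc (Fin.toℕ-fromℕ k)))
        xs , xs∈ , xs≡ = available S G G-increasing f f∈ (β ∘ inject₁)
          (λ i j eq → β< (inject₁ i) (inject₁ j)
            (trans (Fin.toℕ-inject₁ j) (trans eq (cong ℕ.suc (sym (Fin.toℕ-inject₁ i))))))
          (P ∘ inject₁) (P∈ ∘ inject₁) b
          (λ i eq → ℕ.<-≤-trans
            (β< (inject₁ i) (fromℕ k)
              (trans (Fin.toℕ-fromℕ k) (trans (sym eq) (cong ℕ.suc (sym (Fin.toℕ-inject₁ i))))))
            (min⁺≤ (elements (β (fromℕ k))) b∈))
        y , zs∈ , y≡ = continue xs∈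
    in xs ∷ʳ y , zs∈ , (begin
      Vec.map toℤ (xs ∷ʳ y)
        ≡⟨ Vec.map-∷ʳ toℤ y xs ⟩
      Vec.map toℤ xs ∷ʳ toℤ y
        ≡⟨ cong₂ _∷ʳ_ xs≡ y≡ ⟩
      tabulate (λ j → blockValue G f (selector S j) (β (inject₁ j)) (P (inject₁ j)))
        ∷ʳ blockValue G f newSelector (β (fromℕ k)) (P (fromℕ k))
        ≡⟨ cong₂ _∷ʳ_
             (Vec.tabulate-cong λ j → cong (λ s → blockValue G f s (β (inject₁ j)) (P (inject₁ j)))
               (sym (snoc-inject₁ (selector S) newSelector j)))
             (cong (λ s → blockValue G f s (β (fromℕ k)) (P (fromℕ k)))
               (sym (snoc-fromℕ (selector S) newSelector))) ⟩
      tabulate (value′ ∘ inject₁) ∷ʳ value′ (fromℕ k)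
        ≡⟨ tabulate-∷ʳ value′ ⟨
      tabulate value′ ∎)
    where
    open ≡-Reasoning
    value′ : Fin (suc k) → ℤ
    value′ j = blockValue G f (selector′ j) (β j) (P j)

  solution : Solution (suc k) A T
  solution = record
    { selector         = selector′
    ; separated        = λ {G} {K} G⊊K → snoc-all {f = selector S} {newSelector}
        (λ (s : Selector) → (proj₂ s ⟨$⟩ G) <ᶠ (proj₂ s ⟨$⟩ K))
        (separated S {G} {K} G⊊K) (Good.separated (φ-good K) {G} G⊊K)
    ; Available        = Available′
    ; available-mono   = λ G K G⊆K (e , ((L , L⊊G , ch) , P∈) , ext) →
        e , ((L , ⊊-⊆-trans {L} {G} {K} L⊊G G⊆K , ch) , P∈) , ext
    ; available-finite = Available′-finite
    ; available⊆A      = λ {G} → Available′⊆A {G}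
    ; available        = available′
    }
    where
    ⊊-⊆-trans : ∀ {L G K : 𝒫f ℕ^ℕ} → L ⊊ G → G ⊆ᶠ K → L ⊊ K
    ⊊-⊆-trans (L⊆G , L≉G) G⊆K = (λ x∈ → G⊆K (L⊆G x∈)) , λ (_ , K⊆L) →
      L≉G (L⊆G , λ x∈ → K⊆L (G⊆K x∈))

tensorSolution : ∀ k (p : Fin (suc k) → βℕ) → (∀ i → Idempotent (p i) × p i ∈ 𝒥ₚ) →
        ∀ A → A ∈ members (⨂ k p) → ∀ T → Solution (suc k) A T
tensorSolution zero    p hyp A A∈ T = Extension.solution emptySolution (p zero)
  (proj₁ (hyp zero)) (proj₂ (hyp zero)) A (λ { {[]} _ → A∈ })
tensorSolution (suc k) p hyp A A∈ T = Extension.solution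
  (tensorSolution k (p ∘ inject₁) (hyp ∘ inject₁) _ A∈ T) (p (fromℕ (suc k)))
  (proj₁ (hyp (fromℕ (suc k)))) (proj₂ (hyp (fromℕ (suc k)))) A id

consecutive⇒increasing : ∀ {G : ℕ⁺ → 𝒫f ℕ^ℕ} → (∀ {K L M : 𝒫f ℕ^ℕ} → K ⊊ L → L ⊊ M → K ⊊ M) →
  (∀ i → G i ⊊ G (i +⁺ 1⁺)) → ∀ i j → value i < value j → G i ⊊ G j
consecutive⇒increasing {G} trans⊊ step i j i<j =
  subst (λ j → G i ⊊ G j)
    (ℕ⁺-≡ (trans (ℕ.+-suc (value i) _) (ℕ.m+[n∸m]≡n i<j)))
    (go (value j ℕ.∸ suc (value i)))
  where
  go : ∀ d → G i ⊊ G (i +⁺ ⟨ suc d ⟩)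
  go zero    = step i
  go (suc d) = subst (λ j → G i ⊊ G j)
    (ℕ⁺-≡ (trans (ℕ.+-assoc (value i) (suc d) 1) (cong (value i ℕ.+_) (ℕ.+-comm (suc d) 1))))
    (trans⊊ {G i} {G (i +⁺ ⟨ suc d ⟩)} {G (i +⁺ ⟨ suc d ⟩ +⁺ 1⁺)} (go d) (step (i +⁺ ⟨ suc d ⟩)))

corollary1p30 : (k : ℕ) (p : Fin (suc k) → βℕ) →
    let
      m = suc k
      Conclusion =
        (A : Pred (Vec ℕ⁺ m) 0ℓ) → A ∈ members (⨂ k p) →
        (T : 𝒫f ℙ) →
        Σ (Fin m → 𝒫f-setoid ℕ^ℕ ⟶ₛ ℕ⁺-setoid) λ α →
        Σ (Fin m → 𝒫f-setoid ℕ^ℕ ⟶ₛ 𝒫f-setoid ℕ⁺-setoid) λ H →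
          ((G K : 𝒫f ℕ^ℕ) → G ⊊ K → (i : Fin m) → (H i ⟨$⟩ G) <ᶠ (H i ⟨$⟩ K))
          ×
          ((G : ℕ⁺ → 𝒫f ℕ^ℕ) → (∀ i → G i ⊊ G (i +⁺ 1⁺)) →
           (β : Fin m → 𝒫f ℕ⁺-setoid) → (∀ (j : Fin k) → β (inject₁ j) <ᶠ β (suc j)) →
           (f : ℕ⁺ → ℕ⁺ → ℕ⁺) → (∀ i → f i ∈ᶠ G i) →
           (P : Fin m → Polynomial₀) → (∀ j → P j ∈ᶠ T) →
           tabulate (λ j →
             toℤ (∑[ i ∈ β j ] (α j ⟨$⟩ G i))
               + eval (P j) (toℤ (∑[ i ∈ β j ] ∑[ t ∈ H j ⟨$⟩ G i ] f i t)))
             ∈ℤⁿ A)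
    in
      ((∀ i → MinimalIdempotent (p i)) → Conclusion)
      ×
      ((∀ i → Idempotent (p i) × p i ∈ 𝒥ₚ) → Conclusion)
corollary1p30 k p =
  (λ minimal → conclude λ i → let idem , p∈K = minimal i in idem , Minimal.minimal⇒𝒥ₚ (p i) idem p∈K) ,
  conclude
  where
  conclude : (∀ i → Idempotent (p i) × p i ∈ 𝒥ₚ) → _
  conclude hyp A A∈ T =
    (proj₁ ∘ selector S) , (proj₂ ∘ selector S) , (λ G K G⊊K → separated S {G} {K} G⊊K) ,
    λ G G-step β β< f f∈ P P∈ →
      let n = ⟨ suc (max (β (fromℕ k))) ⟩
          xs , xs∈ , xs≡ = available S G
            (consecutive⇒increasing {G} (λ {K} {L} {M} → ⊊-trans {K} {L} {M}) G-step) f f∈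
            β (adjacent β β<) P P∈
            n (λ i eq → s≤s (ℕ.≤-reflexive (cong (max ∘ β)
              (Fin.toℕ-injective (trans (ℕ.suc-injective eq) (sym (Fin.toℕ-fromℕ k)))))))
      in xs , available⊆A S {G n} xs∈ , xs≡
    where
    S = tensorSolution k p hyp A A∈ T
    open Classical (excludedMiddle (p zero))
    open FiniteSets ℕ^ℕ using (⊊-trans)

    adjacent : ∀ (β : Fin (suc k) → 𝒫f ℕ⁺-setoid) → (∀ (j : Fin k) → β (inject₁ j) <ᶠ β (suc j)) →
               ∀ i j → toℕ j ≡ ℕ.suc (toℕ i) → β i <ᶠ β j
    adjacent β β< i (suc j) eq =
      subst (λ i → β i <ᶠ β (suc j))
        (Fin.toℕ-injective (trans (Fin.toℕ-inject₁ j) (ℕ.suc-injective eq))) (β< j)
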